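{- Let $K\ge1$ be an integer with $K\equiv\pm1\pmod6$, and let $p_1,\dots,p_r$ be the distinct primes dividing $K^2+4$. For every integer $m>1$ there exists $N$ such that for all $n\ge N$, $\pi_K^n(m)=24\cdot p_1^{j_1}\cdots p_r^{j_r}$ for some integers $j_1,\dots,j_r\ge0$.
   Context: The $K$-Fibonacci sequence is $F_{K,0}=0$, $F_{K,1}=1$, $F_{K,n}=K F_{K,n-1}+F_{K,n-2}$; for an integer $m>1$, $\pi_K(m)$ is the length of its shortest period modulo $m$; iterates are $\pi_K^1=\pi_K$ and $\pi_K^{n+1}(m)=\pi_K(\pi_K^n(m))$. -}

module Defs where

open import Data.Nat using (ℕ; zero; suc; _+_; _*_; _<_; ∣_-_∣)
open import Data.Nat.Divisibility using (_∣_)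
open import Data.Product using (Σ; _×_; ∃-syntax)
open import Relation.Binary.PropositionalEquality using (_≡_)

kfib : ℕ → ℕ → ℕ
kfib K zero = 0
kfib K (suc zero) = 1
kfib K (suc (suc n)) = K * kfib K (suc n) + kfib K n

_≡_[mod_] : ℕ → ℕ → ℕ → Set
a ≡ b [mod m ] = m ∣ ∣ a - b ∣

IsPeriod : ℕ → ℕ → ℕ → Set
IsPeriod K m k = 0 < k × (∀ n → kfib K (n + k) ≡ kfib K n [mod m ])

IsPi : ℕ → ℕ → ℕ → Set
IsPi K m k = IsPeriod K m k × (∀ j → IsPeriod K m j → k Data.Nat.≤ j)

PiIter : ℕ → ℕ → ℕ → ℕ → Set
PiIter K zero m x = m ≡ x
PiIter K (suc n) m x = ∃[ y ] (PiIter K n m y × IsPi K y x)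

{-# OPTIONS --safe #-}

-- In A = ℤ[α] with α² = Kα + 1 one has αⁿ = F(n-1) + F(n)α, so k is a period modulo m iff
-- αᵏ ≡ 1 (mod m). Put D = K² + 4 = (2α - K)². For an odd prime p = 2t + 1, Frobenius and Fermat give
-- 2αᵖ ≡ K + D^t (2α - K) (mod p). Hence π(p) divides 4p if p ∣ D, and 8t(t+1), all of whose prime
-- factors are smaller than p, otherwise. Moreover if k is a period modulo m and c ∣ m, then ck is a
-- period modulo cm. Consequently the largest prime q ≥ 5 of m not dividing D loses one from its
-- exponent at each application of π, until only 2, 3 and the primes dividing D remain. For y built from
-- these, 24y is a period modulo 144y (it is for y = 1), so the exponents of 2 and 3 drop to 3 and 1.
-- In the other direction, π(m) is even for m > 2 (αᵏ has norm (-1)ᵏ), 2 ∣ m gives 3 ∣ π(m), and 3 ∣ m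
-- gives 8 ∣ π(m), so that 24 divides every iterate from the fifth on.
module Submission where

open import Defs
open import Algebra.Bundles using (CommutativeRing; CommutativeSemiring)
open import Data.Fin.Base using (zero; suc; toℕ; inject₁)
open import Data.Fin.Properties using (toℕ<n; toℕ-inject₁; toℕ-fromℕ)
open import Data.Integer.Base as ℤ using (ℤ; -[1+_]; 0ℤ; 1ℤ; -1ℤ)
import Data.Integer.Divisibility.Signed as Signed
import Data.Integer.Properties as ℤ
import Data.Integer.Tactic.RingSolver as ℤSolver
open import Data.List.Base using ([]; _∷_)
open import Data.List.Relation.Unary.All using (All; []; _∷_)
open import Data.Nat.Base as ℕ using (ℕ; zero; suc; NonZero; z≤n; s≤s)
open import Data.Nat.Combinatorics using (_C_; nCn≡1; nC1≡n; nCk+nC[k+1]≡[n+1]C[k+1]; k>n⇒nCk≡0)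
open import Data.Nat.Coprimality using (Coprime; coprime?; coprime-Bézout; coprime-divisor)
open import Data.Nat.Divisibility
open import Data.Nat.DivMod using (m≡m%n+[m/n]*n; m%n<n)
open import Data.Nat.GCD using (module Bézout)
open import Data.Nat.Induction using (<-rec)
open import Data.Nat.ListAction using (product)
open import Data.Nat.Primality using (Prime; prime?; euclidsLemma; prime⇒irreducible; prime⇒nonZero; ¬prime[0]; ¬prime[1])
open import Data.Nat.Primality.Factorisation using (factorise; module PrimeFactorisation)
import Data.Nat.Properties as ℕ
open import Data.Nat.Tactic.RingSolver using (solve-∀)
open import Data.Product.Base using (∃-syntax; _×_; _,_; proj₁; proj₂)
open import Data.Sum.Base using (_⊎_; inj₁; inj₂; [_,_]′)
open import Data.Vec.Functional using (Vector; tail; init; last)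
open import Function.Base using (_∘_)
open import Level using (_⊔_; 0ℓ)
open import Relation.Binary.PropositionalEquality as ≡ using (_≡_)
open import Relation.Nullary using (¬_; contradiction; yes; no; Dec)
open import Relation.Nullary.Decidable using (from-no; from-yes; _×-dec_; map′)

-- Freshman's dream and Fermat's little theorem

-- The absorption identity for binomial coefficients, by induction through Pascal's rule. Written
-- without division, it reduces divisibility of a binomial coefficient by a prime to Euclid's lemma.
[1+k]*[1+n]C[1+k] : ∀ n k → suc k ℕ.* (suc n C suc k) ≡ suc n ℕ.* (n C k)
[1+k]*[1+n]C[1+k] n zero =
  ≡.trans (ℕ.*-identityˡ (suc n C 1)) (≡.trans (nC1≡n (suc n)) (≡.sym (ℕ.*-identityʳ (suc n))))
[1+k]*[1+n]C[1+k] zero (suc k) =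
  ≡.trans (≡.cong (suc (suc k) ℕ.*_) (k>n⇒nCk≡0 {1} {suc (suc k)} (s≤s (s≤s z≤n))))
    (≡.trans (ℕ.*-zeroʳ (suc (suc k))) (≡.sym (≡.trans (ℕ.+-identityʳ _) (k>n⇒nCk≡0 {0} {suc k} (s≤s z≤n)))))
[1+k]*[1+n]C[1+k] (suc n) (suc k) = begin
  suc (suc k) ℕ.* (suc (suc n) C suc (suc k))
    ≡⟨ ≡.cong (suc (suc k) ℕ.*_) (nCk+nC[k+1]≡[n+1]C[k+1] (suc n) (suc k)) ⟨
  suc (suc k) ℕ.* (a ℕ.+ b)
    ≡⟨ expand k a b ⟩
  a ℕ.+ (suc k ℕ.* a ℕ.+ suc (suc k) ℕ.* b)
    ≡⟨ ≡.cong₂ (λ u v → a ℕ.+ (u ℕ.+ v)) ([1+k]*[1+n]C[1+k] n k) ([1+k]*[1+n]C[1+k] n (suc k)) ⟩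
  a ℕ.+ (suc n ℕ.* (n C k) ℕ.+ suc n ℕ.* (n C suc k))
    ≡⟨ ≡.cong (a ℕ.+_) (ℕ.*-distribˡ-+ (suc n) (n C k) (n C suc k)) ⟨
  a ℕ.+ suc n ℕ.* (n C k ℕ.+ n C suc k)
    ≡⟨ ≡.cong (λ u → a ℕ.+ suc n ℕ.* u) (nCk+nC[k+1]≡[n+1]C[k+1] n k) ⟩
  suc (suc n) ℕ.* (suc n C suc k) ∎
  where
  open ≡.≡-Reasoning
  a = suc n C suc k
  b = suc n C suc (suc k)
  expand : ∀ k a b → suc (suc k) ℕ.* (a ℕ.+ b) ≡ a ℕ.+ (suc k ℕ.* a ℕ.+ suc (suc k) ℕ.* b)
  expand = solve-∀

-- By the absorption identity p divides `suc k` times the coefficient, and p cannot divide the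
-- smaller positive number `suc k`.
prime∣C : ∀ {p k} → Prime p → suc k ℕ.< p → p ∣ p C suc k
prime∣C {suc n} {k} pr k<p
  with euclidsLemma (suc k) (suc n C suc k) pr
         (divides (n C k) (≡.trans ([1+k]*[1+n]C[1+k] n k) (ℕ.*-comm (suc n) (n C k))))
... | inj₁ p∣k = contradiction p∣k (>⇒∤ k<p)
... | inj₂ p∣C = p∣C

module FreshmansDream {c ℓ} (S : CommutativeSemiring c ℓ) where
  open CommutativeSemiring S hiding (zero)
  open import Algebra.Properties.Semiring.Exp semiring
  open import Algebra.Properties.Semiring.Mult semiring using (×-congˡ) renaming (_×_ to _·_; ×-assocˡ to ·-assocˡ)
  open import Algebra.Properties.Semiring.Sum semiring
  open import Algebra.Properties.CommutativeMonoid.Mult +-commutativeMonoid using () renaming (×-distrib-+ to ·-distrib-+)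
  import Algebra.Properties.CommutativeSemiring.Binomial S as Binomial
  open import Relation.Binary.Reasoning.Setoid setoid

  sum-multiple : ∀ m {n} (f : Vector Carrier n) → (∀ i → ∃[ w ] f i ≈ m · w) → ∃[ w ] sum f ≈ m · w
  sum-multiple m {zero} f h = 0# , sym (m·0 m)
    where
    m·0 : ∀ m → m · 0# ≈ 0#
    m·0 zero = refl
    m·0 (suc m) = trans (+-identityˡ _) (m·0 m)
  sum-multiple m {suc n} f h with h zero | sum-multiple m (tail f) (λ i → h (suc i))
  ... | u , eu | v , ev = u + v , trans (+-cong eu ev) (sym (·-distrib-+ u v m))

  -- Every binomial term except the first and the last is a multiple of p. The error stays explicit
  -- as `p · w`, so that one statement serves both ℕ, where it yields Fermat's theorem, and rings in
  -- which p vanishes.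
  freshman : ∀ {p} → Prime p → ∀ x y → ∃[ w ] (x + y) ^ p ≈ (x ^ p + y ^ p) + p · w
  freshman {p@(suc n)} pr x y = let w , ew = sum-multiple p (init (tail t)) middle in w , (begin
    (x + y) ^ p                                    ≈⟨ Binomial.theorem p x y ⟩
    t zero + sum (tail t)                          ≈⟨ +-congˡ (sum-init-last (tail t)) ⟩
    t zero + (sum (init (tail t)) + last (tail t)) ≈⟨ +-cong first (+-cong ew final) ⟩
    y ^ p + (p · w + x ^ p)                        ≈⟨ +-congˡ (+-comm _ _) ⟩
    y ^ p + (x ^ p + p · w)                        ≈⟨ +-assoc _ _ _ ⟨
    (y ^ p + x ^ p) + p · w                        ≈⟨ +-congʳ (+-comm _ _) ⟩
    (x ^ p + y ^ p) + p · w                        ∎)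
    where
    t = Binomial.binomialTerm x y p
    first : t zero ≈ y ^ p
    first = trans (+-identityʳ _) (*-identityˡ _)
    final : last (tail t) ≈ x ^ p
    final rewrite toℕ-fromℕ n | nCn≡1 p | ℕ.n∸n≡0 n = trans (+-identityʳ _) (*-identityʳ _)
    middle : ∀ i → ∃[ w ] init (tail t) i ≈ p · w
    middle i with prime∣C {k = toℕ (inject₁ i)} pr
                    (s≤s (≡.subst (ℕ._< n) (≡.sym (toℕ-inject₁ i)) (toℕ<n i)))
    ... | divides q eq = q · b , trans (×-congˡ (≡.trans eq (ℕ.*-comm q p))) (sym (·-assocˡ b p q))
      where b = Binomial.binomial x y p (suc (inject₁ i))

module _ where
  open FreshmansDream ℕ.+-*-commutativeSemiring
  open import Algebra.Properties.Semiring.Exp ℕ.+-*-semiring using () renaming (_^_ to _^ˢ_)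
  open import Algebra.Properties.Semiring.Mult ℕ.+-*-semiring using () renaming (_×_ to _·_)

  ^ˢ≡^ : ∀ x n → x ^ˢ n ≡ x ℕ.^ n
  ^ˢ≡^ x zero = ≡.refl
  ^ˢ≡^ x (suc n) = ≡.cong (x ℕ.*_) (^ˢ≡^ x n)

  ·≡* : ∀ n x → n · x ≡ n ℕ.* x
  ·≡* zero x = ≡.refl
  ·≡* (suc n) x = ≡.cong (x ℕ.+_) (·≡* n x)

  -- Induction on k, with the freshman's dream applied to 1 + k. The additive form avoids
  -- subtraction in ℕ.
  fermat : ∀ {p} → Prime p → ∀ k → ∃[ w ] k ℕ.^ p ≡ k ℕ.+ p ℕ.* w
  fermat {suc n} pr zero = 0 , ≡.sym (ℕ.*-zeroʳ n)
  fermat {p} pr (suc k) =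
    let u , eu = fermat pr k
        v , ev = freshman pr 1 k
    in u ℕ.+ v , (begin
      suc k ℕ.^ p                       ≡⟨ ^ˢ≡^ (suc k) p ⟨
      suc k ^ˢ p                        ≡⟨ ev ⟩
      1 ^ˢ p ℕ.+ k ^ˢ p ℕ.+ p · v       ≡⟨ ≡.cong₂ ℕ._+_ (≡.cong₂ ℕ._+_ (^ˢ≡^ 1 p) (^ˢ≡^ k p)) (·≡* p v) ⟩
      1 ℕ.^ p ℕ.+ k ℕ.^ p ℕ.+ p ℕ.* v   ≡⟨ ≡.cong₂ (λ a b → a ℕ.+ b ℕ.+ p ℕ.* v) (ℕ.^-zeroˡ p) eu ⟩
      1 ℕ.+ (k ℕ.+ p ℕ.* u) ℕ.+ p ℕ.* v ≡⟨ regroup k p u v ⟩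
      suc k ℕ.+ p ℕ.* (u ℕ.+ v)         ∎)
    where
    open ≡.≡-Reasoning
    regroup : ∀ k p u v → 1 ℕ.+ (k ℕ.+ p ℕ.* u) ℕ.+ p ℕ.* v ≡ suc k ℕ.+ p ℕ.* (u ℕ.+ v)
    regroup = solve-∀

-- Commutative rings of odd prime characteristic

module NaturalMultiples {c ℓ} (R : CommutativeRing c ℓ) where
  open CommutativeRing R hiding (zero)
  open import Algebra.Properties.Semiring.Exp semiring public using (_^_; ^-homo-*; ^-assocʳ; ^-congˡ; ^-congʳ)
  open import Algebra.Properties.Semiring.Mult semiring public using (×1-homo-*; ×-homo-+; ×-assoc-*; ×-congʳ) renaming (_×_ to _·_)

  ι : ℕ → Carrier
  ι n = n · 1#

  ι-+ : ∀ m n → ι (m ℕ.+ n) ≈ ι m + ι n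
  ι-+ = ×-homo-+ 1#

  ι-* : ∀ m n → ι (m ℕ.* n) ≈ ι m * ι n
  ι-* = ×1-homo-*

  ι-1 : ι 1 ≈ 1#
  ι-1 = +-identityʳ 1#

  ι-^ : ∀ m n → ι (m ℕ.^ n) ≈ ι m ^ n
  ι-^ m zero = ι-1
  ι-^ m (suc n) = trans (ι-* m (m ℕ.^ n)) (*-congˡ (ι-^ m n))

  ι-≡ : ∀ {m n} → m ≡ n → ι m ≈ ι n
  ι-≡ ≡.refl = refl

  ·≈ι* : ∀ n x → n · x ≈ ι n * x
  ·≈ι* n x = sym (trans (×-assoc-* n 1# x) (×-congʳ n (*-identityˡ x)))

  1^n≈1 : ∀ n → 1# ^ n ≈ 1#
  1^n≈1 zero = refl
  1^n≈1 (suc n) = trans (*-identityˡ _) (1^n≈1 n)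

module OddCharacteristic {c ℓ} (S : CommutativeRing c ℓ)
  (p t : ℕ) (p≡1+2t : p ≡ suc (2 ℕ.* t)) (pr : Prime p)
  (ιp≈0 : CommutativeRing._≈_ S (NaturalMultiples.ι S p) (CommutativeRing.0# S)) where
  open CommutativeRing S hiding (zero)
  open NaturalMultiples S
  open import Algebra.Properties.CommutativeSemiring.Exp commutativeSemiring using (^-distrib-*)
  open import Algebra.Properties.Ring ring using (-‿distribˡ-*; -‿distribʳ-*; -‿involutive; +-cancelʳ)
  open import Algebra.Solver.Ring.NaturalCoefficients.Default commutativeSemiring using (solve; _:+_; _:*_; _:=_)
  open import Relation.Binary.Reasoning.Setoid setoid

  ιp*≈0 : ∀ w → ι p * w ≈ 0#
  ιp*≈0 w = trans (*-congʳ ιp≈0) (zeroˡ w)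

  ∣⇒ι≈0 : ∀ {n} → p ∣ n → ι n ≈ 0#
  ∣⇒ι≈0 {n} (divides q eq) = trans (ι-≡ eq) (trans (ι-* q p) (trans (*-congˡ ιp≈0) (zeroʳ _)))

  frobenius : ∀ x y → (x + y) ^ p ≈ x ^ p + y ^ p
  frobenius x y = let w , e = FreshmansDream.freshman commutativeSemiring pr x y in
    trans e (trans (+-congˡ (trans (·≈ι* p w) (ιp*≈0 w))) (+-identityʳ _))

  ι^p : ∀ k → ι k ^ p ≈ ι k
  ι^p k = let w , e = fermat pr k in begin
    ι k ^ p           ≈⟨ ι-^ k p ⟨
    ι (k ℕ.^ p)       ≈⟨ ι-≡ e ⟩
    ι (k ℕ.+ p ℕ.* w) ≈⟨ ι-+ k _ ⟩
    ι k + ι (p ℕ.* w) ≈⟨ +-congˡ (trans (ι-* p w) (ιp*≈0 (ι w))) ⟩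
    ι k + 0#          ≈⟨ +-identityʳ _ ⟩
    ι k               ∎

  -- 2 is invertible with inverse t + 1, because 2(t + 1) = p + 1.
  halve : ∀ {x y} → ι 2 * x ≈ ι 2 * y → x ≈ y
  halve {x} {y} e = trans (sym (h x)) (trans (*-congˡ e) (h y))
    where
    2[1+t] : ∀ t → suc t ℕ.* 2 ≡ suc (suc (2 ℕ.* t))
    2[1+t] = solve-∀
    h : ∀ x → ι (suc t) * (ι 2 * x) ≈ x
    h x = begin
      ι (suc t) * (ι 2 * x) ≈⟨ *-assoc _ _ _ ⟨
      ι (suc t) * ι 2 * x   ≈⟨ *-congʳ (ι-* (suc t) 2) ⟨
      ι (suc t ℕ.* 2) * x   ≈⟨ *-congʳ (ι-≡ (≡.trans (2[1+t] t) (≡.cong suc (≡.sym p≡1+2t)))) ⟩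
      (1# + ι p) * x        ≈⟨ *-congʳ (trans (+-congˡ ιp≈0) (+-identityʳ 1#)) ⟩
      1# * x                ≈⟨ *-identityˡ x ⟩
      x                     ∎

  module Root (K : ℕ) (α : Carrier) (α²≈Kα+1 : α * α ≈ ι K * α + 1#) where

    D : ℕ
    D = K ℕ.* K ℕ.+ 4

    -- γ = 2α - K is the difference of the two roots of x² = Kx + 1.
    k γ : Carrier
    k = - ι K
    γ = α + α + k

    K+k≈0 : ι K + k ≈ 0#
    K+k≈0 = -‿inverseʳ (ι K)

    kk≈KK : k * k ≈ ι K * ι K
    kk≈KK = trans (sym (-‿distribˡ-* (ι K) k)) (trans (-‿cong (sym (-‿distribʳ-* (ι K) (ι K)))) (-‿involutive _))

    ιD : ι D ≈ ι K * ι K + ι 2 * ι 2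
    ιD = trans (ι-+ (K ℕ.* K) 4) (+-cong (ι-* K K) (ι-* 2 2))

    double : ∀ x → ι 2 * x ≈ x + x
    double x = trans (*-congʳ (+-congˡ ι-1)) (trans (distribʳ x 1# 1#) (+-cong (*-identityˡ x) (*-identityˡ x)))

    γ²≈D : γ * γ ≈ ι D
    γ²≈D = begin
      γ * γ
        ≈⟨ solve 2 (λ a k → (a :+ a :+ k) :* (a :+ a :+ k) := (a :* a :+ a :* a) :+ (a :* a :+ a :* a) :+ (a :* k :+ a :* k :+ (a :* k :+ a :* k)) :+ k :* k) refl α k ⟩
      (α * α + α * α) + (α * α + α * α) + (α * k + α * k + (α * k + α * k)) + k * k
        ≈⟨ +-cong (+-congʳ (+-cong 2α² 2α²)) kk≈KK ⟩
      (a² + a²) + (a² + a²) + (α * k + α * k + (α * k + α * k)) + ι K * ι K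
        -- The semiring solver knows no negatives: `k` enters as a free variable, and the factor K +
        -- k is isolated so that it can be replaced by 0 afterwards.
        ≈⟨ solve 4 (λ a K k o → (K :* a :+ o) :+ (K :* a :+ o) :+ ((K :* a :+ o) :+ (K :* a :+ o)) :+ (a :* k :+ a :* k :+ (a :* k :+ a :* k)) :+ K :* K
                             := (a :+ a :+ (a :+ a)) :* (K :+ k) :+ (K :* K :+ (o :+ o :+ (o :+ o)))) refl α (ι K) k 1# ⟩
      (α + α + (α + α)) * (ι K + k) + (ι K * ι K + (1# + 1# + (1# + 1#)))
        ≈⟨ +-congʳ (trans (*-congˡ K+k≈0) (zeroʳ _)) ⟩
      0# + (ι K * ι K + (1# + 1# + (1# + 1#)))
        ≈⟨ +-identityˡ _ ⟩
      ι K * ι K + (1# + 1# + (1# + 1#))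
        ≈⟨ +-congˡ (trans (double (ι 2)) (+-cong ι2 ι2)) ⟨
      ι K * ι K + ι 2 * ι 2
        ≈⟨ ιD ⟨
      ι D ∎
      where
      a² = ι K * α + 1#
      2α² = +-cong α²≈Kα+1 α²≈Kα+1
      ι2 = +-congˡ {1#} ι-1

    K+γ≈2α : ι K + γ ≈ α + α
    K+γ≈2α = begin
      ι K + (α + α + k) ≈⟨ solve 3 (λ a K k → K :+ (a :+ a :+ k) := a :+ a :+ (K :+ k)) refl α (ι K) k ⟩
      α + α + (ι K + k) ≈⟨ trans (+-congˡ K+k≈0) (+-identityʳ _) ⟩
      α + α             ∎

    -- Since 2α = K + γ, Frobenius splits the p-th power; Fermat fixes the integers 2 and K, and γ^p
    -- = γ(γ²)^t = γD^t.
    2α^p≈K+γD^t : ι 2 * α ^ p ≈ ι K + γ * ι D ^ t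
    2α^p≈K+γD^t = begin
      ι 2 * α ^ p         ≈⟨ *-congʳ (ι^p 2) ⟨
      ι 2 ^ p * α ^ p     ≈⟨ ^-distrib-* (ι 2) α p ⟨
      (ι 2 * α) ^ p       ≈⟨ ^-congˡ p (trans (double α) (sym K+γ≈2α)) ⟩
      (ι K + γ) ^ p       ≈⟨ frobenius (ι K) γ ⟩
      ι K ^ p + γ ^ p     ≈⟨ +-cong (ι^p K) (^-congʳ γ p≡1+2t) ⟩
      ι K + γ * γ ^ (2 ℕ.* t) ≈⟨ +-congˡ (*-congˡ (^-assocʳ γ 2 t)) ⟨
      ι K + γ * (γ ^ 2) ^ t ≈⟨ +-congˡ (*-congˡ (^-congˡ t (trans (*-congˡ (*-identityʳ γ)) γ²≈D))) ⟩
      ι K + γ * ι D ^ t   ∎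

    -1*-1≈1 : - 1# * - 1# ≈ 1#
    -1*-1≈1 = trans (sym (-‿distribˡ-* 1# (- 1#))) (trans (-‿cong (*-identityˡ _)) (-‿involutive 1#))

    x+1≈0⇒x≈-1 : ∀ {x} → x + 1# ≈ 0# → x ≈ - 1#
    x+1≈0⇒x≈-1 {x} e = +-cancelʳ 1# x (- 1#) (trans e (sym (-‿inverseˡ 1#)))

    x≈-1⇒x²≈1 : ∀ {x} → x ≈ - 1# → x ^ 2 ≈ 1#
    x≈-1⇒x²≈1 e = trans (*-cong e (trans (*-identityʳ _) e)) -1*-1≈1

    -- As t > 0, D^t vanishes along with D, which leaves 2α^p = K. Then 4(α^(2p) + 1) = K² + 4 = D =
    -- 0, so α^(2p) = -1.
    ramified : p ∣ D → α ^ (p ℕ.* 2 ℕ.* 2) ≈ 1#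
    ramified p∣D = trans (sym (^-assocʳ α (p ℕ.* 2) 2)) (x≈-1⇒x²≈1 (x+1≈0⇒x≈-1 (halve (halve (begin
      ι 2 * (ι 2 * (α ^ (p ℕ.* 2) + 1#))
        ≈⟨ *-congˡ (*-congˡ (+-congʳ (^-assocʳ α p 2))) ⟨
      ι 2 * (ι 2 * (x * (x * 1#) + 1#))
        ≈⟨ solve 3 (λ T x o → T :* (T :* (x :* (x :* o) :+ o)) := (T :* x) :* (T :* x) :* o :+ T :* T :* o) refl (ι 2) x 1# ⟩
      ι 2 * x * (ι 2 * x) * 1# + ι 2 * ι 2 * 1#
        ≈⟨ +-cong (trans (*-identityʳ _) (*-cong 2x≈K 2x≈K)) (*-identityʳ _) ⟩
      ι K * ι K + ι 2 * ι 2
        ≈⟨ ιD ⟨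
      ι D
        ≈⟨ ∣⇒ι≈0 p∣D ⟩
      0#
        ≈⟨ trans (*-congˡ (zeroʳ _)) (zeroʳ _) ⟨
      ι 2 * (ι 2 * 0#) ∎)))))
      where
      x = α ^ p
      D^t≈0 : ∀ t → p ≡ suc (2 ℕ.* t) → ι D ^ t ≈ 0#
      D^t≈0 zero p≡1 = contradiction (≡.subst Prime p≡1 pr) ¬prime[1]
      D^t≈0 (suc t) _ = trans (*-congʳ (∣⇒ι≈0 p∣D)) (zeroˡ _)
      2x≈K : ι 2 * x ≈ ι K
      2x≈K = trans 2α^p≈K+γD^t (trans (+-congˡ (trans (*-congˡ (D^t≈0 t p≡1+2t)) (zeroʳ γ))) (+-identityʳ _))

    -- `α + k` is α - K, the inverse of α and the negative of the conjugate root.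
    α[α+k]≈1 : α * (α + k) ≈ 1#
    α[α+k]≈1 = begin
      α * (α + k)               ≈⟨ distribˡ α α k ⟩
      α * α + α * k             ≈⟨ +-congʳ α²≈Kα+1 ⟩
      ι K * α + 1# + α * k      ≈⟨ solve 4 (λ a K k o → K :* a :+ o :+ a :* k := a :* (K :+ k) :+ o) refl α (ι K) k 1# ⟩
      α * (ι K + k) + 1#        ≈⟨ +-congʳ (trans (*-congˡ K+k≈0) (zeroʳ α)) ⟩
      0# + 1#                   ≈⟨ +-identityˡ 1# ⟩
      1#                        ∎

    -- Frobenius fixes α: 2α^p = K + γ = 2α. Cancelling one α from α^p = α leaves the exponent p - 1
    -- = 2t.
    split : ι D ^ t ≈ 1# → α ^ (2 ℕ.* t) ≈ 1#
    split D^t≈1 = begin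
      α ^ (2 ℕ.* t)                       ≈⟨ *-identityˡ _ ⟨
      1# * α ^ (2 ℕ.* t)                  ≈⟨ *-congʳ (trans (*-comm _ _) α[α+k]≈1) ⟨
      (α + k) * α * α ^ (2 ℕ.* t)         ≈⟨ *-assoc _ _ _ ⟩
      (α + k) * (α * α ^ (2 ℕ.* t))       ≈⟨ *-congˡ (^-congʳ α p≡1+2t) ⟨
      (α + k) * α ^ p                     ≈⟨ *-congˡ (halve (trans 2α^p≈K+γD^t (trans (+-congˡ (trans (*-congˡ D^t≈1) (*-identityʳ γ))) (trans K+γ≈2α (sym (double α)))))) ⟩
      (α + k) * α                         ≈⟨ trans (*-comm _ _) α[α+k]≈1 ⟩
      1#                                  ∎

    -- Frobenius conjugates α: 2α^p = K - γ, so α^p = K - α and α^(p+1) = α(K - α) = -1. Here p + 1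
    -- = 2(t + 1).
    inert : ι D ^ t + 1# ≈ 0# → α ^ (2 ℕ.* suc t ℕ.* 2) ≈ 1#
    inert D^t+1≈0 = trans (sym (^-assocʳ α (2 ℕ.* suc t) 2)) (x≈-1⇒x²≈1 (x+1≈0⇒x≈-1 (begin
      α ^ (2 ℕ.* suc t) + 1#              ≈⟨ +-congʳ (^-congʳ α (≡.trans (2[1+t] t) (≡.cong suc (≡.sym p≡1+2t)))) ⟩
      α * α ^ p + 1#                      ≈⟨ +-congˡ α[α+k]≈1 ⟨
      α * α ^ p + α * (α + k)             ≈⟨ distribˡ α _ _ ⟨
      α * (α ^ p + (α + k))               ≈⟨ *-congˡ (halve 2[x+α+k]≈0) ⟩
      α * 0#                              ≈⟨ zeroʳ α ⟩
      0#                                  ∎)))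
      where
      2[1+t] : ∀ t → 2 ℕ.* suc t ≡ suc (suc (2 ℕ.* t))
      2[1+t] = solve-∀
      2[x+α+k]≈0 : ι 2 * (α ^ p + (α + k)) ≈ ι 2 * 0#
      2[x+α+k]≈0 = begin
        ι 2 * (α ^ p + (α + k))                     ≈⟨ distribˡ _ _ _ ⟩
        ι 2 * α ^ p + ι 2 * (α + k)                 ≈⟨ +-cong 2α^p≈K+γD^t (double (α + k)) ⟩
        ι K + γ * d + (α + k + (α + k))             ≈⟨ solve 5 (λ a K k g d → K :+ g :* d :+ (a :+ k :+ (a :+ k)) := (K :+ k) :+ (g :* d :+ (a :+ a :+ k))) refl α (ι K) k γ d ⟩
        (ι K + k) + (γ * d + γ)                     ≈⟨ +-cong K+k≈0 (+-congˡ (sym (*-identityʳ γ))) ⟩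
        0# + (γ * d + γ * 1#)                       ≈⟨ trans (+-identityˡ _) (sym (distribˡ γ d 1#)) ⟩
        γ * (d + 1#)                                ≈⟨ trans (*-congˡ D^t+1≈0) (zeroʳ γ) ⟩
        0#                                          ≈⟨ zeroʳ _ ⟨
        ι 2 * 0#                                    ∎
        where d = ι D ^ t

    -- Euler's criterion without subtraction: for D^t = e + 1 one has D^p = D + De(e + 2), so by
    -- Fermat p divides e or e + 2, that is, D^t is 1 or -1. The exponent 8t(t + 1) is a common
    -- multiple of the exponents 2t and 4(t + 1) of these two cases.
    unramified : ¬ p ∣ D → α ^ (8 ℕ.* (t ℕ.* suc t)) ≈ 1#
    unramified p∤D = go (D ℕ.^ t) ≡.refl
      where
      split-exp : ∀ t → 8 ℕ.* (t ℕ.* suc t) ≡ 2 ℕ.* t ℕ.* (4 ℕ.* suc t)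
      split-exp = solve-∀
      inert-exp : ∀ t → 8 ℕ.* (t ℕ.* suc t) ≡ 2 ℕ.* suc t ℕ.* 2 ℕ.* (2 ℕ.* t)
      inert-exp = solve-∀
      multiple : ∀ {n} a b → n ≡ a ℕ.* b → α ^ a ≈ 1# → α ^ n ≈ 1#
      multiple a b n≡ab e = trans (^-congʳ α n≡ab) (trans (sym (^-assocʳ α a b)) (trans (^-congˡ b e) (1^n≈1 b)))
      D^p : ∀ {e} → D ℕ.^ t ≡ suc e → D ℕ.^ p ≡ D ℕ.+ D ℕ.* (e ℕ.* (2 ℕ.+ e))
      D^p {e} eq = ≡.trans (≡.cong (D ℕ.^_) p≡1+2t) (≡.trans (≡.cong (D ℕ.*_) (≡.trans (≡.cong (D ℕ.^_) (ℕ.*-comm 2 t)) (≡.trans (≡.sym (ℕ.^-*-assoc D t 2)) (≡.cong (ℕ._^ 2) eq)))) (expand D e))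
        where
        expand : ∀ d e → d ℕ.* (suc e ℕ.* (suc e ℕ.* 1)) ≡ d ℕ.+ d ℕ.* (e ℕ.* (2 ℕ.+ e))
        expand = solve-∀
      go : ∀ d → D ℕ.^ t ≡ d → α ^ (8 ℕ.* (t ℕ.* suc t)) ≈ 1#
      go zero eq = contradiction (ℕ.m^n≡0⇒m≡0 D t eq) (ℕ.m+1+n≢0 (K ℕ.* K))
      go (suc e) eq with euclidsLemma D (e ℕ.* (2 ℕ.+ e)) pr p∣De[2+e]
        where
        p∣De[2+e] : p ∣ D ℕ.* (e ℕ.* (2 ℕ.+ e))
        p∣De[2+e] = let w , f = fermat pr D in
          divides w (≡.trans (ℕ.+-cancelˡ-≡ D _ _ (≡.trans (≡.sym (D^p eq)) f)) (ℕ.*-comm p w))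
      ... | inj₁ p∣D = contradiction p∣D p∤D
      ... | inj₂ p∣e[2+e] with euclidsLemma e (2 ℕ.+ e) pr p∣e[2+e]
      ... | inj₁ p∣e = multiple (2 ℕ.* t) (4 ℕ.* suc t) (split-exp t)
              (split (trans (sym (ι-^ D t)) (trans (ι-≡ eq) (trans (+-congˡ (∣⇒ι≈0 p∣e)) (+-identityʳ 1#)))))
      ... | inj₂ p∣2+e = multiple (2 ℕ.* suc t ℕ.* 2) (2 ℕ.* t) (inert-exp t)
              (inert (trans (+-congʳ (trans (sym (ι-^ D t)) (ι-≡ eq))) (trans (+-comm _ 1#) (∣⇒ι≈0 p∣2+e))))

-- Congruences modulo integers in a commutative ring

module Congruence {c ℓ} (R : CommutativeRing c ℓ) where
  open CommutativeRing R hiding (zero)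
  open NaturalMultiples R
  open import Algebra.Properties.Ring ring using (-‿distribʳ-*; -‿+-comm)
  open import Algebra.Solver.Ring.NaturalCoefficients.Default commutativeSemiring using (solve; _:+_; _:*_; _:=_; con)
  open import Relation.Binary.Reasoning.Setoid setoid

  infix 4 _∼_[_]
  record _∼_[_] (x y : Carrier) (m : ℕ) : Set (c ⊔ ℓ) where
    constructor _,_
    field
      cofactor : Carrier
      equation : x ≈ y + ι m * cofactor

  module _ {m : ℕ} where

    ≈⇒∼ : ∀ {x y} → x ≈ y → x ∼ y [ m ]
    ≈⇒∼ x≈y = 0# , trans x≈y (sym (trans (+-congˡ (zeroʳ _)) (+-identityʳ _)))

    ∼-sym : ∀ {x y} → x ∼ y [ m ] → y ∼ x [ m ]
    ∼-sym {x} {y} (u , e) = - u , sym (begin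
      x + ι m * - u             ≈⟨ +-cong e (sym (-‿distribʳ-* (ι m) u)) ⟩
      y + ι m * u + - (ι m * u) ≈⟨ +-assoc _ _ _ ⟩
      y + (ι m * u + - (ι m * u)) ≈⟨ trans (+-congˡ (-‿inverseʳ _)) (+-identityʳ y) ⟩
      y                         ∎)

    ∼-trans : ∀ {x y z} → x ∼ y [ m ] → y ∼ z [ m ] → x ∼ z [ m ]
    ∼-trans {x} {y} {z} (u , e) (v , f) = v + u , (begin
      x                       ≈⟨ trans e (+-congʳ f) ⟩
      z + ι m * v + ι m * u   ≈⟨ +-assoc _ _ _ ⟩
      z + (ι m * v + ι m * u) ≈⟨ +-congˡ (distribˡ _ _ _) ⟨
      z + ι m * (v + u)       ∎)

    +-cong-∼ : ∀ {x x′ y y′} → x ∼ x′ [ m ] → y ∼ y′ [ m ] → x + y ∼ x′ + y′ [ m ]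
    +-cong-∼ {x′ = x′} {y′ = y′} (u , e) (v , f) = u + v , trans (+-cong e f)
      (solve 5 (λ x y m u v → x :+ m :* u :+ (y :+ m :* v) := x :+ y :+ m :* (u :+ v)) refl x′ y′ (ι m) u v)

    *-cong-∼ : ∀ {x x′ y y′} → x ∼ x′ [ m ] → y ∼ y′ [ m ] → x * y ∼ x′ * y′ [ m ]
    *-cong-∼ {x′ = x′} {y′ = y′} (u , e) (v , f) = x′ * v + u * y′ + ι m * u * v , trans (*-cong e f)
      (solve 5 (λ x y m u v → (x :+ m :* u) :* (y :+ m :* v) := x :* y :+ m :* (x :* v :+ u :* y :+ m :* u :* v)) refl x′ y′ (ι m) u v)

    -‿cong-∼ : ∀ {x y} → x ∼ y [ m ] → - x ∼ - y [ m ]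
    -‿cong-∼ {x} {y} (u , e) = - u , (begin
      - x                   ≈⟨ -‿cong e ⟩
      - (y + ι m * u)       ≈⟨ -‿+-comm y (ι m * u) ⟨
      - y + - (ι m * u)     ≈⟨ +-congˡ (-‿distribʳ-* (ι m) u) ⟩
      - y + ι m * - u       ∎)

  -- The carrier is unchanged and only the equality is coarsened. This suffices because the results
  -- in characteristic p hold for rings with an arbitrary equality `_≈_`.
  quotientRing : ℕ → CommutativeRing c (c ⊔ ℓ)
  quotientRing m = record
    { Carrier = Carrier
    ; _≈_ = _∼_[ m ]
    ; _+_ = _+_
    ; _*_ = _*_
    ; -_ = -_
    ; 0# = 0#
    ; 1# = 1#
    ; isCommutativeRing = record
      { isRing = record
        { +-isAbelianGroup = record
          { isGroup = record
            { isMonoid = record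
              { isSemigroup = record
                { isMagma = record
                  { isEquivalence = record { refl = ≈⇒∼ refl ; sym = ∼-sym ; trans = ∼-trans }
                  ; ∙-cong = +-cong-∼
                  }
                ; assoc = λ x y z → ≈⇒∼ (+-assoc x y z)
                }
              ; identity = (λ x → ≈⇒∼ (+-identityˡ x)) , λ x → ≈⇒∼ (+-identityʳ x)
              }
            ; inverse = (λ x → ≈⇒∼ (-‿inverseˡ x)) , λ x → ≈⇒∼ (-‿inverseʳ x)
            ; ⁻¹-cong = -‿cong-∼
            }
          ; comm = λ x y → ≈⇒∼ (+-comm x y)
          }
        ; *-cong = *-cong-∼
        ; *-assoc = λ x y z → ≈⇒∼ (*-assoc x y z)
        ; *-identity = (λ x → ≈⇒∼ (*-identityˡ x)) , λ x → ≈⇒∼ (*-identityʳ x)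
        ; distrib = (λ x y z → ≈⇒∼ (distribˡ x y z)) , λ x y z → ≈⇒∼ (distribʳ x y z)
        }
      ; *-comm = λ x y → ≈⇒∼ (*-comm x y)
      }
    }

  ιm∼0 : ∀ m → ι m ∼ 0# [ m ]
  ιm∼0 m = 1# , sym (trans (+-identityˡ _) (*-identityʳ _))

  ^-cong-∼ : ∀ {m x y} n → x ∼ y [ m ] → x ^ n ∼ y ^ n [ m ]
  ^-cong-∼ zero e = ≈⇒∼ refl
  ^-cong-∼ (suc n) e = *-cong-∼ e (^-cong-∼ n e)

  module Quotient (m : ℕ) where
    private module Q = NaturalMultiples (quotientRing m)

    -- Powers and multiples in a quotient do not unfold to those of R for an open exponent.
    quotient-^ : ∀ x n → x Q.^ n ≡ x ^ n
    quotient-^ x zero = ≡.refl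
    quotient-^ x (suc n) = ≡.cong (x *_) (quotient-^ x n)

    quotient-ι : ∀ n → Q.ι n ≡ ι n
    quotient-ι zero = ≡.refl
    quotient-ι (suc n) = ≡.cong (1# +_) (quotient-ι n)

  module _ {p} (pr : Prime p) (t : ℕ) (p≡1+2t : p ≡ suc (2 ℕ.* t))
           (K : ℕ) (α : Carrier) (α²≈Kα+1 : α * α ≈ ι K * α + 1#) where
    open Quotient p
    private
      ιp≈0 : NaturalMultiples.ι (quotientRing p) p ∼ 0# [ p ]
      ιp≈0 = ≡.subst (_∼ 0# [ p ]) (≡.sym (quotient-ι p)) (ιm∼0 p)
      module Root = OddCharacteristic.Root (quotientRing p) p t p≡1+2t pr ιp≈0 K α
        (≡.subst (λ k → α * α ∼ k * α + 1# [ p ]) (≡.sym (quotient-ι K)) (≈⇒∼ α²≈Kα+1))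

    α^4p∼1 : p ∣ K ℕ.* K ℕ.+ 4 → α ^ (p ℕ.* 2 ℕ.* 2) ∼ 1# [ p ]
    α^4p∼1 p∣D = ≡.subst (_∼ 1# [ p ]) (quotient-^ α (p ℕ.* 2 ℕ.* 2)) (Root.ramified p∣D)

    α^8t[1+t]∼1 : ¬ p ∣ K ℕ.* K ℕ.+ 4 → α ^ (8 ℕ.* (t ℕ.* suc t)) ∼ 1# [ p ]
    α^8t[1+t]∼1 p∤D = ≡.subst (_∼ 1# [ p ]) (quotient-^ α (8 ℕ.* (t ℕ.* suc t))) (Root.unramified p∤D)

  ∼-∣ : ∀ {m n x y} → m ∣ n → x ∼ y [ n ] → x ∼ y [ m ]
  ∼-∣ {m} {n} {x} {y} (divides q n≡qm) (u , e) = ι q * u , (begin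
    x                     ≈⟨ e ⟩
    y + ι n * u           ≈⟨ +-congˡ (*-congʳ (trans (ι-≡ n≡qm) (trans (ι-* q m) (*-comm _ _)))) ⟩
    y + ι m * ι q * u     ≈⟨ +-congˡ (*-assoc _ _ _) ⟩
    y + ι m * (ι q * u)   ∎)

  -- The binomial expansion cut off after the linear term; the induction gathers all the rest in a
  -- multiple of m².
  [1+x]^n : ∀ m u n → ∃[ w ] (1# + ι m * u) ^ n ≈ 1# + ι n * (ι m * u) + ι m * ι m * w
  [1+x]^n m u zero = 0# , sym (trans (+-cong (trans (+-congˡ (zeroˡ _)) (+-identityʳ 1#)) (zeroʳ _)) (+-identityʳ 1#))
  [1+x]^n m u (suc n) = let w , e = [1+x]^n m u n in ι n * u * u + w + ι m * u * w , (begin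
    (1# + ι m * u) * (1# + ι m * u) ^ n ≈⟨ *-congˡ e ⟩
    (1# + ι m * u) * (1# + ι n * (ι m * u) + ι m * ι m * w)
      ≈⟨ solve 4 (λ m n u w → (con 1 :+ m :* u) :* (con 1 :+ n :* (m :* u) :+ m :* m :* w)
                    := con 1 :+ (con 1 :+ n) :* (m :* u) :+ m :* m :* (n :* u :* u :+ w :+ m :* u :* w)) refl (ι m) (ι n) u w ⟩
    1# + ι (suc n) * (ι m * u) + ι m * ι m * (ι n * u * u + w + ι m * u * w) ∎)

  -- (1 + mu)^n ≡ 1 + nmu (mod m²), and nm divides m² whenever n divides m.
  ∼1-lift : ∀ {m n x} → n ∣ m → x ∼ 1# [ m ] → x ^ n ∼ 1# [ n ℕ.* m ]
  ∼1-lift {m} {n} {x} (divides q m≡qn) (u , e) = let w , f = [1+x]^n m u n in u + ι q * w , (begin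
    x ^ n                                         ≈⟨ trans (^-congˡ n e) f ⟩
    1# + ι n * (ι m * u) + ι m * ι m * w          ≈⟨ +-congˡ (*-congʳ (*-congʳ (trans (ι-≡ m≡qn) (ι-* q n)))) ⟩
    1# + ι n * (ι m * u) + ι q * ι n * ι m * w
      ≈⟨ solve 6 (λ o q n m u w → o :+ n :* (m :* u) :+ q :* n :* m :* w := o :+ n :* m :* (u :+ q :* w)) refl 1# (ι q) (ι n) (ι m) u w ⟩
    1# + ι n * ι m * (u + ι q * w)                ≈⟨ +-congˡ (*-congʳ (ι-* n m)) ⟨
    1# + ι (n ℕ.* m) * (u + ι q * w)              ∎)

  private
    -- Let x - y = mu = nv. Multiplying mu by 1 = am - bn gives am·nv - bn·mu = mn(av - bu), which
    -- is the cofactor used.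
    bezout-∼ : ∀ {m n x y} a b → 1 ℕ.+ b ℕ.* n ≡ a ℕ.* m → x ∼ y [ m ] → x ∼ y [ n ] → x ∼ y [ m ℕ.* n ]
    bezout-∼ {m} {n} {x} {y} a b eq (u , e) (v , f) = ι a * v + - (ι b * u) , (begin
      x ≈⟨ e ⟩
      y + M * u ≈⟨ +-congˡ (begin
        M * u ≈⟨ trans (+-congˡ (-‿inverseʳ _)) (+-identityʳ _) ⟨
        M * u + (M * N * (ι b * u) + - (M * N * (ι b * u)))
          ≈⟨ +-assoc _ _ _ ⟨
        M * u + M * N * (ι b * u) + - (M * N * (ι b * u))
          ≈⟨ +-cong (solve 4 (λ M N b u → M :* u :+ M :* N :* (b :* u) := (con 1 :+ b :* N) :* (M :* u)) refl M N (ι b) u) (-‿distribʳ-* _ _) ⟩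
        (1# + ι b * N) * (M * u) + M * N * - (ι b * u)
          ≈⟨ +-congʳ (*-cong (trans (+-congˡ (sym (ι-* b n))) (trans (ι-≡ eq) (ι-* a m))) Mu≈Nv) ⟩
        ι a * M * (N * v) + M * N * - (ι b * u)
          ≈⟨ solve 5 (λ a M N v w → a :* M :* (N :* v) :+ M :* N :* w := M :* N :* (a :* v :+ w)) refl (ι a) M N v (- (ι b * u)) ⟩
        M * N * (ι a * v + - (ι b * u))
          ≈⟨ *-congʳ (ι-* m n) ⟨
        ι (m ℕ.* n) * (ι a * v + - (ι b * u)) ∎) ⟩
      y + ι (m ℕ.* n) * (ι a * v + - (ι b * u)) ∎)
      where
      open import Algebra.Properties.Ring ring using (+-cancelˡ)
      M = ι m
      N = ι n
      Mu≈Nv : M * u ≈ N * v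
      Mu≈Nv = +-cancelˡ y _ _ (trans (sym e) f)

  -- Uniqueness in the Chinese remainder theorem; the two sign patterns of the Bézout identity
  -- differ by exchanging m and n.
  ∼-coprime : ∀ {m n x y} → Coprime m n → x ∼ y [ m ] → x ∼ y [ n ] → x ∼ y [ m ℕ.* n ]
  ∼-coprime {m} {n} {x} {y} cop e f with coprime-Bézout cop
  ... | Bézout.+- a b eq = bezout-∼ a b eq e f
  ... | Bézout.-+ a b eq = ≡.subst (x ∼ y [_]) (ℕ.*-comm n m) (bezout-∼ b a eq f e)

-- Periods as exponents of α

open import Data.Integer.Base using (+_)
open import Relation.Binary.PropositionalEquality using (refl; cong; cong₂; sym; trans; subst)

-- The pair (a , b) stands for a + bα, where α² = κα + 1.
module QuadraticRing (κ : ℤ) where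
  private
    infixl 6 _⊕_
    infixl 7 _⊛_

    _⊕_ _⊛_ : ℤ × ℤ → ℤ × ℤ → ℤ × ℤ
    (a , b) ⊕ (c , d) = a ℤ.+ c , b ℤ.+ d
    (a , b) ⊛ (c , d) = a ℤ.* c ℤ.+ b ℤ.* d , a ℤ.* d ℤ.+ b ℤ.* c ℤ.+ κ ℤ.* (b ℤ.* d)

    ⊝_ : ℤ × ℤ → ℤ × ℤ
    ⊝ (a , b) = ℤ.- a , ℤ.- b

    ⊛-assoc : ∀ x y z → (x ⊛ y) ⊛ z ≡ x ⊛ (y ⊛ z)
    ⊛-assoc (a , b) (c , d) (e , f) = cong₂ _,_ (first κ a b c d e f) (second κ a b c d e f)
      where
      open import Data.Integer.Base using (_+_; _*_)
      first : ∀ κ a b c d e f → (a * c + b * d) * e + (a * d + b * c + κ * (b * d)) * f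
        ≡ a * (c * e + d * f) + b * (c * f + d * e + κ * (d * f))
      first = ℤSolver.solve-∀
      second : ∀ κ a b c d e f →
        (a * c + b * d) * f + (a * d + b * c + κ * (b * d)) * e + κ * ((a * d + b * c + κ * (b * d)) * f)
        ≡ a * (c * f + d * e + κ * (d * f)) + b * (c * e + d * f) + κ * (b * (c * f + d * e + κ * (d * f)))
      second = ℤSolver.solve-∀

    ⊛-comm : ∀ x y → x ⊛ y ≡ y ⊛ x
    ⊛-comm (a , b) (c , d) = cong₂ _,_ (first a b c d) (second κ a b c d)
      where
      open import Data.Integer.Base using (_+_; _*_)
      first : ∀ a b c d → a * c + b * d ≡ c * a + d * b
      first = ℤSolver.solve-∀
      second : ∀ κ a b c d → a * d + b * c + κ * (b * d) ≡ c * b + d * a + κ * (d * b)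
      second = ℤSolver.solve-∀

    ⊛-identityˡ : ∀ x → (1ℤ , 0ℤ) ⊛ x ≡ x
    ⊛-identityˡ (a , b) = cong₂ _,_ (first a b) (second κ a b)
      where
      open import Data.Integer.Base using (_+_; _*_)
      first : ∀ a b → 1ℤ * a + 0ℤ * b ≡ a
      first = ℤSolver.solve-∀
      second : ∀ κ a b → 1ℤ * b + 0ℤ * a + κ * (0ℤ * b) ≡ b
      second = ℤSolver.solve-∀

    ⊛-distribˡ : ∀ x y z → x ⊛ (y ⊕ z) ≡ x ⊛ y ⊕ x ⊛ z
    ⊛-distribˡ (a , b) (c , d) (e , f) = cong₂ _,_ (first a b c d e f) (second κ a b c d e f)
      where
      open import Data.Integer.Base using (_+_; _*_)
      first : ∀ a b c d e f → a * (c + e) + b * (d + f) ≡ a * c + b * d + (a * e + b * f)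
      first = ℤSolver.solve-∀
      second : ∀ κ a b c d e f → a * (d + f) + b * (c + e) + κ * (b * (d + f))
        ≡ a * d + b * c + κ * (b * d) + (a * f + b * e + κ * (b * f))
      second = ℤSolver.solve-∀

  commutativeRing : CommutativeRing 0ℓ 0ℓ
  commutativeRing = record
    { Carrier = ℤ × ℤ
    ; _≈_ = _≡_
    ; _+_ = _⊕_
    ; _*_ = _⊛_
    ; -_ = ⊝_
    ; 0# = 0ℤ , 0ℤ
    ; 1# = 1ℤ , 0ℤ
    ; isCommutativeRing = record
      { isRing = record
        { +-isAbelianGroup = record
          { isGroup = record
            { isMonoid = record
              { isSemigroup = record
                { isMagma = record { isEquivalence = ≡.isEquivalence ; ∙-cong = cong₂ _⊕_ }
                ; assoc = λ { (a , b) (c , d) (e , f) → cong₂ _,_ (ℤ.+-assoc a c e) (ℤ.+-assoc b d f) }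
                }
              ; identity = (λ { (a , b) → cong₂ _,_ (ℤ.+-identityˡ a) (ℤ.+-identityˡ b) })
                         , λ { (a , b) → cong₂ _,_ (ℤ.+-identityʳ a) (ℤ.+-identityʳ b) }
              }
            ; inverse = (λ { (a , b) → cong₂ _,_ (ℤ.+-inverseˡ a) (ℤ.+-inverseˡ b) })
                      , λ { (a , b) → cong₂ _,_ (ℤ.+-inverseʳ a) (ℤ.+-inverseʳ b) }
            ; ⁻¹-cong = cong ⊝_
            }
          ; comm = λ { (a , b) (c , d) → cong₂ _,_ (ℤ.+-comm a c) (ℤ.+-comm b d) }
          }
        ; *-cong = cong₂ _⊛_
        ; *-assoc = ⊛-assoc
        ; *-identity = ⊛-identityˡ , λ x → trans (⊛-comm x _) (⊛-identityˡ x)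
        ; distrib = ⊛-distribˡ
                  , λ x y z → trans (⊛-comm (y ⊕ z) x) (trans (⊛-distribˡ x y z) (cong₂ _⊕_ (⊛-comm x y) (⊛-comm x z)))
        }
      ; *-comm = ⊛-comm
      }
    }

  -- The product of a + bα with its conjugate, as the two roots have sum κ and product -1.
  norm : ℤ × ℤ → ℤ
  norm (a , b) = a ℤ.* a ℤ.+ κ ℤ.* (a ℤ.* b) ℤ.- b ℤ.* b

-- Translation between periods of `kfib` and powers of α

module Period (K : ℕ) where
  open QuadraticRing (+ K)
  open CommutativeRing commutativeRing using (_+_; _*_; 1#; *-assoc; *-identityʳ; *-identityˡ)
  open NaturalMultiples commutativeRing
  open Congruence commutativeRing

  α α⁻¹ : ℤ × ℤ
  α = 0ℤ , 1ℤ
  α⁻¹ = ℤ.- + K , 1ℤ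

  ι≡ : ∀ n → ι n ≡ (+ n , 0ℤ)
  ι≡ zero = refl
  ι≡ (suc n) = cong (λ z → 1# + z) (ι≡ n)

  α²≡Kα+1 : α * α ≡ ι K * α + 1#
  α²≡Kα+1 = trans (cong₂ _,_ (first (+ K)) (second (+ K))) (cong (λ k → k * α + 1#) (sym (ι≡ K)))
    where
    first : ∀ κ → 0ℤ ℤ.* 0ℤ ℤ.+ 1ℤ ℤ.* 1ℤ ≡ κ ℤ.* 0ℤ ℤ.+ 0ℤ ℤ.* 1ℤ ℤ.+ 1ℤ
    first = ℤSolver.solve-∀
    second : ∀ κ → 0ℤ ℤ.* 1ℤ ℤ.+ 1ℤ ℤ.* 0ℤ ℤ.+ κ ℤ.* (1ℤ ℤ.* 1ℤ) ≡ κ ℤ.* 1ℤ ℤ.+ 0ℤ ℤ.* 0ℤ ℤ.+ κ ℤ.* (0ℤ ℤ.* 1ℤ) ℤ.+ 0ℤ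
    second = ℤSolver.solve-∀

  α⁻¹α≡1 : α⁻¹ * α ≡ 1#
  α⁻¹α≡1 = cong₂ _,_ (first (+ K)) (second (+ K))
    where
    first : ∀ κ → ℤ.- κ ℤ.* 0ℤ ℤ.+ 1ℤ ℤ.* 1ℤ ≡ 1ℤ
    first = ℤSolver.solve-∀
    second : ∀ κ → ℤ.- κ ℤ.* 1ℤ ℤ.+ 1ℤ ℤ.* 0ℤ ℤ.+ κ ℤ.* (1ℤ ℤ.* 1ℤ) ≡ 0ℤ
    second = ℤSolver.solve-∀

  α*_ : ∀ x → α * x ≡ (proj₂ x , proj₁ x ℤ.+ + K ℤ.* proj₂ x)
  α* (a , b) = cong₂ _,_ (first a b) (second (+ K) a b)
    where
    first : ∀ a b → 0ℤ ℤ.* a ℤ.+ 1ℤ ℤ.* b ≡ b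
    first = ℤSolver.solve-∀
    second : ∀ κ a b → 0ℤ ℤ.* b ℤ.+ 1ℤ ℤ.* a ℤ.+ κ ℤ.* (1ℤ ℤ.* b) ≡ a ℤ.+ κ ℤ.* b
    second = ℤSolver.solve-∀

  -- Multiplication by α performs one step of the recurrence. The exponent is shifted by one because
  -- α^n itself would involve F(-1).
  α^[1+n] : ∀ n → α ^ suc n ≡ (+ kfib K n , + kfib K (suc n))
  α^[1+n] zero = *-identityʳ α
  α^[1+n] (suc n) = trans (cong (α *_) (α^[1+n] n)) (trans (α* (+ kfib K n , + kfib K (suc n))) (cong (+ kfib K (suc n) ,_)
    (trans (cong (λ z → + kfib K n ℤ.+ z) (sym (ℤ.pos-* K (kfib K (suc n))))) (cong (λ n → + n) (ℕ.+-comm (kfib K n) _)))))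

  proj₂-α^ : ∀ n → proj₂ (α ^ n) ≡ + kfib K n
  proj₂-α^ zero = refl
  proj₂-α^ (suc n) = cong proj₂ (α^[1+n] n)

  ι* : ∀ m u → ι m * u ≡ (+ m ℤ.* proj₁ u , + m ℤ.* proj₂ u)
  ι* m (a , b) = trans (cong (_* (a , b)) (ι≡ m)) (cong₂ _,_ (first (+ m) a b) (second (+ K) (+ m) a b))
    where
    first : ∀ m a b → m ℤ.* a ℤ.+ 0ℤ ℤ.* b ≡ m ℤ.* a
    first = ℤSolver.solve-∀
    second : ∀ κ m a b → m ℤ.* b ℤ.+ 0ℤ ℤ.* a ℤ.+ κ ℤ.* (0ℤ ℤ.* b) ≡ m ℤ.* b
    second = ℤSolver.solve-∀

  ∼-components : ∀ {m x y} → x ∼ y [ m ] → + m Signed.∣ proj₁ x ℤ.- proj₁ y × + m Signed.∣ proj₂ x ℤ.- proj₂ y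
  ∼-components {m} {x} {y} (u , e) =
    Signed.divides (proj₁ u) (solved (cong proj₁ e′)) , Signed.divides (proj₂ u) (solved (cong proj₂ e′))
    where
    e′ = trans e (cong (λ z → y + z) (ι* m u))
    cancel : ∀ y m u → y ℤ.+ m ℤ.* u ℤ.- y ≡ u ℤ.* m
    cancel = ℤSolver.solve-∀
    solved : ∀ {x y u} → x ≡ y ℤ.+ + m ℤ.* u → x ℤ.- y ≡ u ℤ.* + m
    solved {y = y} {u} refl = cancel y (+ m) u

  components-∼ : ∀ {m x y} → + m Signed.∣ proj₁ x ℤ.- proj₁ y → + m Signed.∣ proj₂ x ℤ.- proj₂ y → x ∼ y [ m ]
  components-∼ {m} {x} {y} (Signed.divides u e) (Signed.divides v f) =
    (u , v) , sym (trans (cong (λ z → y + z) (ι* m (u , v))) (cong₂ _,_ (solved e) (solved f)))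
    where
    cancel : ∀ x y → y ℤ.+ (x ℤ.- y) ≡ x
    cancel = ℤSolver.solve-∀
    solved : ∀ {x y u} → x ℤ.- y ≡ u ℤ.* + m → y ℤ.+ + m ℤ.* u ≡ x
    solved {x} {y} {u} e = trans (cong (λ z → y ℤ.+ z) (trans (ℤ.*-comm (+ m) u) (sym e))) (cancel x y)

  ∣∣a-b∣∣ : ∀ a b → ℤ.∣ + a ℤ.- + b ∣ ≡ ℕ.∣ a - b ∣
  ∣∣a-b∣∣ a b = trans (cong ℤ.∣_∣ (ℤ.m-n≡m⊖n a b)) (∣⊖∣ a b)
    where
    ∣⊖∣ : ∀ a b → ℤ.∣ a ℤ.⊖ b ∣ ≡ ℕ.∣ a - b ∣
    ∣⊖∣ zero zero = refl
    ∣⊖∣ zero (suc b) = refl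
    ∣⊖∣ (suc a) zero = refl
    ∣⊖∣ (suc a) (suc b) = trans (cong ℤ.∣_∣ (ℤ.[1+m]⊖[1+n]≡m⊖n a b)) (∣⊖∣ a b)

  -- A record, so that powers of α with literal exponents are never unfolded when types are compared.
  record Per (m k : ℕ) : Set where
    constructor mkPer
    field α^k∼1 : α ^ k ∼ 1# [ m ]
  open Per public

  Per⇒mod : ∀ {m k} → Per m k → ∀ n → kfib K (n ℕ.+ k) ≡ kfib K n [mod m ]
  Per⇒mod {m} {k} (mkPer α^k∼1) n = ≡.subst (m ∣_) (∣∣a-b∣∣ (kfib K (n ℕ.+ k)) (kfib K n))
    (≡.subst₂ (λ x y → m ∣ ℤ.∣ x ℤ.- y ∣) (proj₂-α^ (n ℕ.+ k)) (proj₂-α^ n)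
      (Signed.∣⇒∣ᵤ (proj₂ (∼-components α^[n+k]∼α^n))))
    where
    α^[n+k]∼α^n : α ^ (n ℕ.+ k) ∼ α ^ n [ m ]
    α^[n+k]∼α^n = ∼-trans (≈⇒∼ (^-homo-* α n k)) (∼-trans (*-cong-∼ {x = α ^ n} (≈⇒∼ refl) α^k∼1) (≈⇒∼ (*-identityʳ (α ^ n))))

  -- Two congruences are enough: they say that α^(k+1) is congruent to α, and α is a unit. The same
  -- fact makes being a period decidable.
  mod⇒Per : ∀ {m k} → kfib K k ≡ 0 [mod m ] → kfib K (suc k) ≡ 1 [mod m ] → Per m k
  mod⇒Per {m} {k} F≡0 F≡1 = mkPer
    (∼-trans (≈⇒∼ (trans (sym (*-identityˡ (α ^ k))) (trans (cong (_* α ^ k) (sym α⁻¹α≡1)) (*-assoc α⁻¹ α (α ^ k)))))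
      (∼-trans (*-cong-∼ {x = α⁻¹} (≈⇒∼ refl) α^[1+k]∼α) (≈⇒∼ α⁻¹α≡1)))
    where
    signed : ∀ {a b} → a ≡ b [mod m ] → + m Signed.∣ + a ℤ.- + b
    signed {a} {b} h = Signed.∣ᵤ⇒∣ (≡.subst (m ∣_) (sym (∣∣a-b∣∣ a b)) h)
    α^[1+k]∼α : α ^ suc k ∼ α [ m ]
    α^[1+k]∼α = ∼-trans (≈⇒∼ (α^[1+n] k)) (components-∼ (signed {kfib K k} {0} F≡0) (signed {kfib K (suc k)} {1} F≡1))

  isPeriod : ∀ {m k} → 0 ℕ.< k → Per m k → IsPeriod K m k
  isPeriod 0<k h = 0<k , Per⇒mod h

  isPeriod⁻¹ : ∀ {m k} → IsPeriod K m k → Per m k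
  isPeriod⁻¹ {m} {k} (_ , h) = mod⇒Per {m} {k} (h 0) (h 1)

  -- α has norm -1; multiplicativity of the norm is checked only for the factor α.
  norm-α^ : ∀ n → norm (α ^ suc n) ≡ ℤ.- norm (α ^ n)
  norm-α^ n = trans (cong norm (α* (α ^ n))) (flip (+ K) (proj₁ (α ^ n)) (proj₂ (α ^ n)))
    where
    flip : ∀ κ a b → b ℤ.* b ℤ.+ κ ℤ.* (b ℤ.* (a ℤ.+ κ ℤ.* b)) ℤ.- (a ℤ.+ κ ℤ.* b) ℤ.* (a ℤ.+ κ ℤ.* b)
      ≡ ℤ.- (a ℤ.* a ℤ.+ κ ℤ.* (a ℤ.* b) ℤ.- b ℤ.* b)
    flip = ℤSolver.solve-∀

  norm-odd : ∀ j → norm (α ^ suc (j ℕ.* 2)) ≡ -1ℤ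
  norm-odd zero = trans (norm-α^ 0) (cong ℤ.-_ norm1)
    where
    c : ∀ κ → 1ℤ ℤ.* 1ℤ ℤ.+ κ ℤ.* (1ℤ ℤ.* 0ℤ) ℤ.- 0ℤ ℤ.* 0ℤ ≡ 1ℤ
    c = ℤSolver.solve-∀
    norm1 : norm 1# ≡ 1ℤ
    norm1 = c (+ K)
  norm-odd (suc j) = trans (norm-α^ (suc (suc (j ℕ.* 2)))) (trans (cong ℤ.-_ (norm-α^ (suc (j ℕ.* 2)))) (trans (ℤ.neg-involutive _) (norm-odd j)))

  norm-∼1 : ∀ {m x} → x ∼ 1# [ m ] → + m Signed.∣ norm x ℤ.- 1ℤ
  norm-∼1 {m} {x} h with ∼-components h
  -- With x = (um + 1) + vmα, this cofactor is what remains of the expanded norm of x after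
  -- subtracting 1 and dividing by m.
  ... | Signed.divides u e , Signed.divides v f = Signed.divides (u ℤ.* u ℤ.* + m ℤ.+ u ℤ.+ u ℤ.+ + K ℤ.* ((u ℤ.* + m ℤ.+ 1ℤ) ℤ.* v) ℤ.- v ℤ.* v ℤ.* + m) (begin
      norm x ℤ.- 1ℤ ≡⟨ cong₂ (λ a b → norm (a , b) ℤ.- 1ℤ) (trans (sym (shift (proj₁ x) 1ℤ)) (cong (λ z → z ℤ.+ 1ℤ) e)) (trans (sym (shift (proj₂ x) 0ℤ)) (cong (λ z → z ℤ.+ 0ℤ) f)) ⟩
      norm (u ℤ.* + m ℤ.+ 1ℤ , v ℤ.* + m ℤ.+ 0ℤ) ℤ.- 1ℤ ≡⟨ expand (+ K) (+ m) u v ⟩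
      (u ℤ.* u ℤ.* + m ℤ.+ u ℤ.+ u ℤ.+ + K ℤ.* ((u ℤ.* + m ℤ.+ 1ℤ) ℤ.* v) ℤ.- v ℤ.* v ℤ.* + m) ℤ.* + m ∎)
    where
    open ≡.≡-Reasoning
    shift : ∀ x y → x ℤ.- y ℤ.+ y ≡ x
    shift = ℤSolver.solve-∀
    expand : ∀ κ m u v →
      (u ℤ.* m ℤ.+ 1ℤ) ℤ.* (u ℤ.* m ℤ.+ 1ℤ) ℤ.+ κ ℤ.* ((u ℤ.* m ℤ.+ 1ℤ) ℤ.* (v ℤ.* m ℤ.+ 0ℤ)) ℤ.- (v ℤ.* m ℤ.+ 0ℤ) ℤ.* (v ℤ.* m ℤ.+ 0ℤ) ℤ.- 1ℤ
      ≡ (u ℤ.* u ℤ.* m ℤ.+ u ℤ.+ u ℤ.+ κ ℤ.* ((u ℤ.* m ℤ.+ 1ℤ) ℤ.* v) ℤ.- v ℤ.* v ℤ.* m) ℤ.* m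
    expand = ℤSolver.solve-∀

-- Smooth numbers

prime∤⇒coprime : ∀ {p m} → Prime p → ¬ p ∣ m → Coprime p m
prime∤⇒coprime pr p∤m (d∣p , d∣m) with prime⇒irreducible pr d∣p
... | inj₁ d≡1 = d≡1
... | inj₂ refl = contradiction d∣m p∤m

parity : ∀ n → ∃[ t ] (n ≡ 2 ℕ.* t ⊎ n ≡ suc (2 ℕ.* t))
parity zero = 0 , inj₁ refl
parity (suc n) with parity n
... | t , inj₁ n≡2t = t , inj₂ (cong suc n≡2t)
... | t , inj₂ n≡1+2t = suc t , inj₁ (trans (cong suc n≡1+2t) (sym (ℕ.*-suc 2 t)))

oddPrime : ∀ {p} → Prime p → p ≡ 2 ⊎ ∃[ t ] (0 ℕ.< t × p ≡ suc (2 ℕ.* t))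
oddPrime {p} pr with parity p
... | t , inj₁ p≡2t with prime⇒irreducible pr (divides t (trans p≡2t (ℕ.*-comm 2 t)))
...   | inj₂ 2≡p = inj₁ (sym 2≡p)
oddPrime {p} pr | zero , inj₂ p≡1 = contradiction (≡.subst Prime p≡1 pr) ¬prime[1]
oddPrime {p} pr | suc t , inj₂ p≡1+2t = inj₂ (suc t , s≤s z≤n , p≡1+2t)

Smooth : (ℕ → Set) → ℕ → Set
Smooth P m = ∀ p → Prime p → p ∣ m → P p

smooth-* : ∀ {P a b} → Smooth P a → Smooth P b → Smooth P (a ℕ.* b)
smooth-* {a = a} {b} sa sb p pr p∣ab with euclidsLemma a b pr p∣ab
... | inj₁ p∣a = sa p pr p∣a
... | inj₂ p∣b = sb p pr p∣b

smooth-1 : ∀ {P} → Smooth P 1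
smooth-1 p pr p∣1 = contradiction (≡.subst Prime (∣1⇒≡1 p∣1) pr) ¬prime[1]

smooth-map : ∀ {P Q : ℕ → Set} → (∀ {p} → Prime p → P p → Q p) → ∀ {m} → Smooth P m → Smooth Q m
smooth-map f s p pr p∣m = f pr (s p pr p∣m)

smooth-∣ : ∀ {P m n} → m ∣ n → Smooth P n → Smooth P m
smooth-∣ m∣n s p pr p∣m = s p pr (∣-trans p∣m m∣n)

smooth-small : ∀ {P b m} → (∀ {p} → p ℕ.≤ b → P p) → 0 ℕ.< m → m ℕ.≤ b → Smooth P m
smooth-small f 0<m m≤b p _ p∣m = f (ℕ.≤-trans (∣⇒≤ {{ℕ.>-nonZero 0<m}} p∣m) m≤b)

-- Runs along the list of prime factors of m, multiplying one of them at a time onto 1.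
smooth-induction : ∀ {P} (Q : ℕ → Set) → Q 1 → (∀ {p m} → Prime p → P p → Q m → Q (p ℕ.* m)) →
  ∀ {m} → 0 ℕ.< m → Smooth P m → Q m
smooth-induction {P} Q Q1 step {m} 0<m s =
  ≡.subst Q (sym isFactorisation) (go factors factorsPrime (≡.subst (Smooth P) isFactorisation s))
  where
  open PrimeFactorisation (factorise m {{ℕ.>-nonZero 0<m}})
  go : ∀ ps → All Prime ps → Smooth P (product ps) → Q (product ps)
  go [] [] _ = Q1
  go (p ∷ ps) (pr ∷ prs) s =
    step pr (s p pr (m∣m*n (product ps))) (go ps prs (smooth-∣ (n∣m*n p) s))

open import Data.Nat.Base using (_+_; _*_; _^_; _≤_; _<_; _%_; _/_)

prime>0 : ∀ {p} → Prime p → 0 < p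
prime>0 {p} pr = ℕ.>-nonZero⁻¹ p {{prime⇒nonZero pr}}

smooth-prime : ∀ {P p} → Prime p → P p → Smooth P p
smooth-prime pr Pp r pr′ r∣p with prime⇒irreducible pr r∣p
... | inj₁ refl = contradiction pr′ ¬prime[1]
... | inj₂ refl = Pp

smooth-^ : ∀ {P c} j → Smooth P c → Smooth P (c ^ j)
smooth-^ zero s = smooth-1
smooth-^ {c = c} (suc j) s = smooth-* {a = c} s (smooth-^ j s)

prime<4 : ∀ {p} → Prime p → p < 4 → p ≡ 2 ⊎ p ≡ 3
prime<4 {0} pr _ = contradiction pr ¬prime[0]
prime<4 {1} pr _ = contradiction pr ¬prime[1]
prime<4 {2} _ _ = inj₁ refl
prime<4 {3} _ _ = inj₂ refl
prime<4 {suc (suc (suc (suc p)))} _ (s≤s (s≤s (s≤s (s≤s ()))))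

-- Collects the factors q into a power, leaving a cofactor whose primes satisfy `P′`. It serves to
-- isolate the prime treated in the descent, and the powers of 2 and 3 at its end.
splitPrime : ∀ {P P′ : ℕ → Set} q → (∀ {p} → Prime p → P p → p ≡ q ⊎ P′ p) → ∀ {m} → 0 < m → Smooth P m →
  ∃[ j ] ∃[ m′ ] (m ≡ q ^ j * m′ × 0 < m′ × Smooth P′ m′)
splitPrime {P} {P′} q split = smooth-induction Q (0 , 1 , refl , s≤s z≤n , smooth-1) step
  where
  Q : ℕ → Set
  Q m = ∃[ j ] ∃[ m′ ] (m ≡ q ^ j * m′ × 0 < m′ × Smooth P′ m′)
  swap : ∀ a b c → a * (b * c) ≡ b * (a * c)
  swap = solve-∀
  step : ∀ {p m} → Prime p → P p → Q m → Q (p * m)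
  step {p} pr Pp (j , m′ , refl , 0<m′ , s) with split pr Pp
  ... | inj₁ refl = suc j , m′ , sym (ℕ.*-assoc q (q ^ j) m′) , 0<m′ , s
  ... | inj₂ P′p = j , p * m′ , swap p (q ^ j) m′ , ℕ.*-mono-≤ (prime>0 pr) 0<m′ , smooth-* {a = p} (smooth-prime pr P′p) s

-- The Pisano map

coprime*∣ : ∀ {a b n} → Coprime a b → a ∣ n → b ∣ n → a * b ∣ n
coprime*∣ {a} {b} cop a∣n (divides q refl) =
  subst (_∣ q * b) (ℕ.*-comm b a) (subst (b * a ∣_) (ℕ.*-comm b q)
    (*-monoʳ-∣ b (coprime-divisor cop (subst (a ∣_) (ℕ.*-comm q b) a∣n))))

least : ∀ {P : ℕ → Set} → (∀ n → Dec (P n)) → ∀ {n} → P n → ∃[ k ] (P k × (∀ j → P j → k ℕ.≤ j))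
least {P} P? {n} Pn = <-rec (λ n → P n → ∃[ k ] (P k × (∀ j → P j → k ℕ.≤ j))) go n Pn
  where
  go : ∀ n → (∀ {i} → i ℕ.< n → P i → ∃[ k ] (P k × (∀ j → P j → k ℕ.≤ j))) → P n → ∃[ k ] (P k × (∀ j → P j → k ℕ.≤ j))
  go n rec Pn with ℕ.anyUpTo? P? n
  ... | yes (i , i<n , Pi) = rec i<n Pi
  ... | no ¬P = n , Pn , λ j Pj → ℕ.≮⇒≥ (λ j<n → ¬P (j , j<n , Pj))

-- Divisibility properties of periods

module PeriodProperties (K : ℕ) where
  open QuadraticRing (+ K)
  open CommutativeRing commutativeRing using (1#; *-identityʳ) renaming (_+_ to _⊕_)
  open NaturalMultiples commutativeRing renaming (_^_ to _^ᴿ_)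
  open Congruence commutativeRing
  open Period K

  D : ℕ
  D = K * K + 4

  per-1 : ∀ k → Per 1 k
  per-1 k = mkPer (components-∼ {1} {α ^ᴿ k} {1#} (1∣z _) (1∣z _))
    where
    1∣z : ∀ z → 1ℤ Signed.∣ z
    1∣z z = Signed.divides z (sym (ℤ.*-identityʳ z))

  per-∣ : ∀ {m n k} → m ∣ n → Per n k → Per m k
  per-∣ m∣n (mkPer e) = mkPer (∼-∣ m∣n e)

  per-multiple : ∀ {m k l} → k ∣ l → Per m k → Per m l
  per-multiple {m} {k} {l} (divides q l≡qk) (mkPer e) = mkPer
    (∼-trans (≈⇒∼ (trans (cong (α ^ᴿ_) (trans l≡qk (ℕ.*-comm q k))) (sym (^-assocʳ α k q))))
      (∼-trans (^-cong-∼ q e) (≈⇒∼ (1^n≈1 q))))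

  per-remainder : ∀ {m k} r q → Per m k → Per m (r + q * k) → Per m r
  per-remainder {m} {k} r q h (mkPer e) = mkPer (∼-trans (∼-sym α^[r+qk]∼α^r) e)
    where
    α^[r+qk]∼α^r : α ^ᴿ (r + q * k) ∼ α ^ᴿ r [ m ]
    α^[r+qk]∼α^r = ∼-trans (≈⇒∼ (^-homo-* α r (q * k)))
      (∼-trans (*-cong-∼ {x = α ^ᴿ r} (≈⇒∼ refl) (α^k∼1 (per-multiple (n∣m*n q) h))) (≈⇒∼ (*-identityʳ (α ^ᴿ r))))

  per-lift : ∀ {m c k} → c ∣ m → Per m k → Per (c * m) (c * k)
  per-lift {m} {c} {k} c∣m (mkPer e) = mkPer
    (∼-trans (≈⇒∼ (trans (cong (α ^ᴿ_) (ℕ.*-comm c k)) (sym (^-assocʳ α k c)))) (∼1-lift c∣m e))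

  per-coprime : ∀ {m n k} → Coprime m n → Per m k → Per n k → Per (m * n) k
  per-coprime cop (mkPer e) (mkPer f) = mkPer (∼-coprime cop e f)

  -- For odd k the norm of α^k is -1, while it is congruent to 1 modulo m; then m would divide -2.
  per-even : ∀ {m k} → 2 < m → Per m k → 2 ∣ k
  per-even {m} {k} 2<m (mkPer e) with parity k
  ... | t , inj₁ k≡2t = divides t (trans k≡2t (ℕ.*-comm 2 t))
  ... | t , inj₂ k≡1+2t = contradiction (Signed.∣⇒∣ᵤ m∣-2) (>⇒∤ 2<m)
    where
    m∣-2 : + m Signed.∣ -[1+ 1 ]
    m∣-2 = ≡.subst (λ z → + m Signed.∣ z ℤ.- 1ℤ)
      (trans (cong (λ k → norm (α ^ᴿ k)) (trans k≡1+2t (cong suc (ℕ.*-comm 2 t)))) (norm-odd t)) (norm-∼1 e)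

  -- The remainder of k modulo d is again an exponent, so it is 0. Minimality is expressed as the
  -- absence of smaller positive exponents, so that the lemma applies both to π(m) and to concrete
  -- values of d.
  leastPer∣ : ∀ {m d k} → .{{_ : NonZero d}} → Per m d → (∀ {r} → 0 < r → r < d → ¬ Per m r) → Per m k → d ∣ k
  leastPer∣ {m} {d} {k} per-d minimal per-k = m%n≡0⇒n∣m k d (r≡0 (k % d) refl)
    where
    r≡0 : ∀ r → k % d ≡ r → k % d ≡ 0
    r≡0 zero eq = eq
    r≡0 (suc r) eq = contradiction
      (per-remainder (k % d) (k / d) per-d (≡.subst (Per m) (m≡m%n+[m/n]*n k d) per-k))
      (minimal (≡.subst (0 <_) (sym eq) (s≤s z≤n)) (m%n<n k d))

  -- All upper bounds on π pass through here: a single exponent k for n bounds π on every divisor of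
  -- n.
  isPi∣ : ∀ {m n x k} → IsPi K m x → m ∣ n → Per n k → x ∣ k
  isPi∣ (isPer@(0<x , _) , minimal) m∣n h =
    leastPer∣ {{ℕ.>-nonZero 0<x}} (isPeriod⁻¹ isPer)
      (λ {r} 0<r r<x per-r → ℕ.<⇒≱ r<x (minimal r (isPeriod 0<r per-r))) (per-∣ m∣n h)

  isPi-per : ∀ {m n x} → IsPi K m x → n ∣ m → Per n x
  isPi-per (isPer , _) n∣m = per-∣ n∣m (isPeriod⁻¹ isPer)

  ι-∼ : ∀ {m a c} u → a ≡ c + m * u → ι a ∼ ι c [ m ]
  ι-∼ {m} {a} {c} u a≡c+mu = ι u , trans (ι-≡ a≡c+mu) (trans (ι-+ c (m * u)) (cong (λ z → ι c ⊕ z) (ι-* m u)))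

  -- α^n is congruent to an integer exactly when m divides F(n), that is, when n is a multiple of
  -- the rank of apparition of m. Whether a multiple of n is a period then depends only on powers of
  -- c.
  record Scalar (m n c : ℕ) : Set where
    constructor scalar
    field α^n∼c : α ^ᴿ n ∼ ι c [ m ]

  kfib⇒scalar : ∀ {m c} n u v → kfib K n ≡ c + m * u → kfib K (suc n) ≡ m * v → Scalar m (suc n) c
  kfib⇒scalar {m} {c} n u v e f = scalar (∼-trans (≈⇒∼ (α^[1+n] n))
    (∼-trans (components-∼ {m} {+ kfib K n , + kfib K (suc n)} {+ c , 0ℤ} first second) (≈⇒∼ (sym (ι≡ c)))))
    where
    cancel : ∀ c z → c ℤ.+ z ℤ.- c ≡ z
    cancel = ℤSolver.solve-∀
    first : + m Signed.∣ + kfib K n ℤ.- + c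
    first = Signed.divides (+ u) (trans (cong (λ a → + a ℤ.- + c) e)
      (trans (cancel (+ c) (+ (m * u))) (trans (cong (λ a → + a) (ℕ.*-comm m u)) (ℤ.pos-* u m))))
    second : + m Signed.∣ + kfib K (suc n) ℤ.- 0ℤ
    second = Signed.divides (+ v) (trans (ℤ.+-identityʳ _) (trans (cong (λ a → + a) (trans f (ℕ.*-comm m v))) (ℤ.pos-* v m)))

  scalar⇒per : ∀ {m n c} j u → Scalar m n c → c ^ j ≡ 1 + m * u → Per m (n * j)
  scalar⇒per {n = n} {c} j u (scalar e) f = mkPer (∼-trans (≈⇒∼ (sym (^-assocʳ α n j)))
    (∼-trans (^-cong-∼ j e) (∼-trans (≈⇒∼ (sym (ι-^ c j))) (∼-trans (ι-∼ u f) (≈⇒∼ ι-1)))))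

  scalar∧per : ∀ {m n c} → Scalar m n c → Per m n → c ≡ 1 [mod m ]
  scalar∧per {m} {n} {c} (scalar e) (mkPer f) =
    ≡.subst (m ∣_) (∣∣a-b∣∣ c 1) (Signed.∣⇒∣ᵤ (≡.subst (λ z → + m Signed.∣ z ℤ.- 1ℤ) (cong proj₁ (ι≡ c))
      (proj₁ (∼-components (∼-trans (∼-sym e) f)))))

  ramifiedPer : ∀ {p} → Prime p → ¬ p ≡ 2 → p ∣ D → Per p (p * 2 * 2)
  ramifiedPer pr p≢2 p∣D with oddPrime pr
  ... | inj₁ p≡2 = contradiction p≡2 p≢2
  ... | inj₂ (t , _ , p≡1+2t) = mkPer (α^4p∼1 pr t p≡1+2t K α α²≡Kα+1 p∣D)

  unramifiedPer : ∀ {p t} → Prime p → p ≡ suc (2 * t) → ¬ p ∣ D → Per p (8 * (t * suc t))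
  unramifiedPer {t = t} pr p≡1+2t p∤D = mkPer (α^8t[1+t]∼1 pr t p≡1+2t K α α²≡Kα+1 p∤D)

-- `PiIter` exposes the last application of π, whereas the descent argues about the first.
PiIter-unroll : ∀ {K} n {m x} → PiIter K (suc n) m x → ∃[ y ] (IsPi K m y × PiIter K n y x)
PiIter-unroll zero (_ , refl , pi) = _ , pi , refl
PiIter-unroll (suc n) (z , it , pi) with PiIter-unroll n it
... | y , pi′ , it′ = y , pi′ , z , it′ , pi

-- Periods modulo 2, 3 and their powers for K coprime to 6

module Coprime6 (K j s : ℕ) (K≡1+2j : K ≡ 1 + 2 * j) (K²≡1+24s : K * K ≡ 1 + 24 * s) where
  open PeriodProperties K
  open Period K

  -- α³ = K + (K² + 1)α with K odd.
  α³∼1[2] : Scalar 2 3 1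
  α³∼1[2] = kfib⇒scalar 2 j (1 + 2 * j + 2 * (j * j))
    (subst (λ k → k * 1 + 0 ≡ 1 + 2 * j) (sym K≡1+2j) (first j))
    (subst (λ k → k * (k * 1 + 0) + 1 ≡ 2 * (1 + 2 * j + 2 * (j * j))) (sym K≡1+2j) (second j))
    where
    first : ∀ j → (1 + 2 * j) * 1 + 0 ≡ 1 + 2 * j
    first = solve-∀
    second : ∀ j → (1 + 2 * j) * ((1 + 2 * j) * 1 + 0) + 1 ≡ 2 * (1 + 2 * j + 2 * (j * j))
    second = solve-∀

  -- α⁴ = (K² + 1) + K(K² + 2)α, where K² is 1 modulo 3.
  α⁴∼2[3] : Scalar 3 4 2
  α⁴∼2[3] = kfib⇒scalar 3 (8 * s) (K * (1 + 8 * s))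
    (trans (F₃ K) (trans (cong (_+ 1) K²≡1+24s) (first s)))
    (trans (F₄ K) (trans (cong (λ q → K * (q + 2)) K²≡1+24s) (second K s)))
    where
    F₃ : ∀ k → k * (k * 1 + 0) + 1 ≡ k * k + 1
    F₃ = solve-∀
    F₄ : ∀ k → k * (k * (k * 1 + 0) + 1) + (k * 1 + 0) ≡ k * (k * k + 2)
    F₄ = solve-∀
    first : ∀ s → 1 + 24 * s + 1 ≡ 2 + 3 * (8 * s)
    first = solve-∀
    second : ∀ k s → k * (1 + 24 * s + 2) ≡ 3 * (k * (1 + 8 * s))
    second = solve-∀

  -- α⁶ = (K⁴ + 3K² + 1) + K(K² + 1)(K² + 3)α. As K² is 1 modulo 8, the constant term is 5, and the
  -- last two factors contribute 2 and 4.
  α⁶∼5[8] : Scalar 8 6 5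
  α⁶∼5[8] = kfib⇒scalar 5 (15 * s + 72 * (s * s)) (K * ((1 + 12 * s) * (1 + 6 * s)))
    (trans (F₅ K) (trans (cong (λ q → q * q + 3 * q + 1) K²≡1+24s) (first s)))
    (trans (F₆ K) (trans (cong (λ q → K * ((q + 1) * (q + 3))) K²≡1+24s) (second K s)))
    where
    F₅ : ∀ k → k * (k * (k * (k * 1 + 0) + 1) + (k * 1 + 0)) + (k * (k * 1 + 0) + 1)
      ≡ k * k * (k * k) + 3 * (k * k) + 1
    F₅ = solve-∀
    F₆ : ∀ k → k * (k * (k * (k * (k * 1 + 0) + 1) + (k * 1 + 0)) + (k * (k * 1 + 0) + 1)) + (k * (k * (k * 1 + 0) + 1) + (k * 1 + 0))
      ≡ k * ((k * k + 1) * (k * k + 3))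
    F₆ = solve-∀
    first : ∀ s → (1 + 24 * s) * (1 + 24 * s) + 3 * (1 + 24 * s) + 1 ≡ 5 + 8 * (15 * s + 72 * (s * s))
    first = solve-∀
    second : ∀ k s → k * ((1 + 24 * s + 1) * (1 + 24 * s + 3)) ≡ 8 * (k * ((1 + 12 * s) * (1 + 6 * s)))
    second = solve-∀

  per-2-3 : Per 2 3
  per-2-3 = scalar⇒per 1 0 α³∼1[2] refl

  per-3-8 : Per 3 8
  per-3-8 = scalar⇒per 2 1 α⁴∼2[3] refl

  per-8-12 : Per 8 12
  per-8-12 = scalar⇒per 2 3 α⁶∼5[8] refl

  -- 144 = 16 · 9: the exponent 12 modulo 8 lifts to 24 modulo 16, and 8 modulo 3 lifts to 24 modulo
  -- 9.
  per-144-24 : Per 144 24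
  per-144-24 = per-coprime (from-yes (coprime? 16 9))
    (per-lift {8} {2} (divides 4 refl) per-8-12) (per-lift {3} {3} ∣-refl per-3-8)

  ¬per-2-1 : ¬ Per 2 1
  ¬per-2-1 per = contradiction (Per⇒mod per 0) (from-no (2 ∣? 1))

  ¬per-3-4 : ¬ Per 3 4
  ¬per-3-4 h = contradiction (scalar∧per α⁴∼2[3] h) (from-no (3 ∣? 1))

  per-2⇒3∣ : ∀ {k} → Per 2 k → 3 ∣ k
  per-2⇒3∣ {k} = leastPer∣ per-2-3 minimal
    where
    minimal : ∀ {r} → 0 < r → r < 3 → ¬ Per 2 r
    minimal {1} _ _ per = ¬per-2-1 per
    -- If 2 were an exponent, so would be 4 = 1 + 3, and hence 1.
    minimal {2} _ _ per = ¬per-2-1 (per-remainder 1 1 per-2-3 (per-multiple (divides 2 refl) per))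
    minimal {suc (suc (suc r))} _ (s≤s (s≤s (s≤s ())))

  -- Every r with 0 < r < 8 has a multiple congruent to 4 modulo 8.
  per-3⇒8∣ : ∀ {k} → Per 3 k → 8 ∣ k
  per-3⇒8∣ {k} = leastPer∣ per-3-8 minimal
    where
    refute : ∀ {r} q i → i * r ≡ 4 + q * 8 → ¬ Per 3 r
    refute {r} q i e per = ¬per-3-4 (per-remainder 4 q per-3-8 (per-multiple (divides i (sym e)) per))
    minimal : ∀ {r} → 0 < r → r < 8 → ¬ Per 3 r
    minimal {1} _ _ = refute {1} 0 4 refl
    minimal {2} _ _ = refute {2} 0 2 refl
    minimal {3} _ _ = refute {3} 1 4 refl
    minimal {4} _ _ = refute {4} 0 1 refl
    minimal {5} _ _ = refute {5} 2 4 refl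
    minimal {6} _ _ = refute {6} 1 2 refl
    minimal {7} _ _ = refute {7} 3 4 refl
    minimal {suc (suc (suc (suc (suc (suc (suc (suc r)))))))} _ (s≤s (s≤s (s≤s (s≤s (s≤s (s≤s (s≤s (s≤s ()))))))))

  module _ {m x} (pi : IsPi K m x) where

    2∣m⇒3∣π : 2 ∣ m → 3 ∣ x
    2∣m⇒3∣π 2∣m = per-2⇒3∣ {x} (isPi-per pi 2∣m)

    3∣m⇒8∣π : 3 ∣ m → 8 ∣ x
    3∣m⇒8∣π 3∣m = per-3⇒8∣ {x} (isPi-per pi 3∣m)

    8∣m⇒6∣π : 8 ∣ m → 6 ∣ x
    8∣m⇒6∣π 8∣m = coprime*∣ {2} {3} (from-yes (coprime? 2 3))
      (per-even (s≤s (s≤s (s≤s z≤n))) (isPi-per pi 8∣m)) (2∣m⇒3∣π (∣-trans (divides 4 refl) 8∣m))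

    6∣m⇒24∣π : 6 ∣ m → 24 ∣ x
    6∣m⇒24∣π 6∣m = coprime*∣ {8} {3} (from-yes (coprime? 8 3)) (3∣m⇒8∣π (∣-trans (divides 2 refl) 6∣m)) (2∣m⇒3∣π (∣-trans (divides 3 refl) 6∣m))

    1<m⇒2∣π⊎3∣π : 1 < m → 2 ∣ x ⊎ 3 ∣ x
    1<m⇒2∣π⊎3∣π 1<m with m ℕ.≟ 2
    ... | yes refl = inj₂ (2∣m⇒3∣π ∣-refl)
    ... | no m≢2 = inj₁ (per-even (ℕ.≤∧≢⇒< 1<m (m≢2 ∘ sym)) (isPi-per pi ∣-refl))

  -- π(m) is divisible by 2 or by 3. In the first case the next iterates are divisible by 3, 8, 6
  -- and 24 in turn; in the second by 8, 6, 24 and again 24. Divisibility by 24 persists since 6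
  -- divides 24.
  24∣π^[5+n] : ∀ {m x} n → 1 < m → PiIter K (5 + n) m x → 24 ∣ x
  24∣π^[5+n] zero 1<m (y₄ , (y₃ , (y₂ , (y₁ , (_ , refl , p₁) , p₂) , p₃) , p₄) , p₅) with 1<m⇒2∣π⊎3∣π p₁ 1<m
  ... | inj₁ 2∣y₁ = 6∣m⇒24∣π p₅ (8∣m⇒6∣π p₄ (3∣m⇒8∣π p₃ (2∣m⇒3∣π p₂ 2∣y₁)))
  ... | inj₂ 3∣y₁ = 6∣m⇒24∣π p₅ (∣-trans (divides 4 refl) (6∣m⇒24∣π p₄ (8∣m⇒6∣π p₃ (3∣m⇒8∣π p₂ 3∣y₁))))
  24∣π^[5+n] (suc n) 1<m (y , it , pi) = 6∣m⇒24∣π pi (∣-trans (divides 4 refl) (24∣π^[5+n] n 1<m it))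

  -- Exponents for prime moduli

  -- The first alternative records `¬ p ∣ D`, so that a prime p dividing D, however large,
  -- contributes only primes below 4 or dividing D.
  PrimePerFactor : ℕ → ℕ → Set
  PrimePerFactor p r = (r < p × ¬ p ∣ D) ⊎ r < 4 ⊎ r ∣ D

  primePer : ∀ {p} → Prime p → ∃[ k ] (0 < k × Smooth (PrimePerFactor p) k × Per p k)
  primePer {p} pr with oddPrime pr
  ... | inj₁ refl = 3 , s≤s z≤n , smooth-small (λ r≤3 → inj₂ (inj₁ (s≤s r≤3))) (s≤s z≤n) ℕ.≤-refl , per-2-3
  ... | inj₂ (t , 0<t , p≡1+2t) with p ∣? D
  ...   | yes p∣D = p * 2 * 2 , ℕ.*-mono-≤ (ℕ.*-mono-≤ 0<p (s≤s (z≤n {1}))) (s≤s (z≤n {1}))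
                  , smooth-* (smooth-* (λ r _ r∣p → inj₂ (inj₂ (∣-trans r∣p p∣D))) 2-smooth) 2-smooth
                  , ramifiedPer pr p≢2 p∣D
    where
    0<p : 0 < p
    0<p = subst (0 <_) (sym p≡1+2t) (s≤s z≤n)
    2-smooth : Smooth (PrimePerFactor p) 2
    2-smooth = smooth-small (λ r≤2 → inj₂ (inj₁ (ℕ.m≤n⇒m≤1+n (s≤s r≤2)))) (s≤s z≤n) ℕ.≤-refl
    p≢2 : ¬ p ≡ 2
    p≢2 p≡2 = contradiction (trans (sym p≡2) p≡1+2t) (ℕ.even≢odd 1 t)
  -- Both t and t + 1 lie below p = 2t + 1 because t > 0, and the factor 8 contributes only the
  -- prime 2.
  ...   | no p∤D = 8 * (t * suc t) , ℕ.*-mono-≤ {1} {8} {1} {t * suc t} (s≤s z≤n) (ℕ.*-mono-≤ 0<t (s≤s (z≤n {t})))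
                  , smooth-* {a = 8} 8-smooth (smooth-* {a = t} (small 0<t (ℕ.n≤1+n t)) (small (s≤s z≤n) ℕ.≤-refl))
                  , unramifiedPer {p} {t} pr p≡1+2t p∤D
    where
    2-smooth : Smooth (PrimePerFactor p) 2
    2-smooth = smooth-small (λ r≤2 → inj₂ (inj₁ (ℕ.m≤n⇒m≤1+n (s≤s r≤2)))) (s≤s z≤n) ℕ.≤-refl
    8-smooth : Smooth (PrimePerFactor p) 8
    8-smooth = smooth-* {a = 2} {4} 2-smooth (smooth-* {a = 2} {2} 2-smooth 2-smooth)
    1+t<p : suc t < p
    1+t<p = subst (suc t <_) (sym p≡1+2t) (s≤s (ℕ.≤-trans (s≤s (ℕ.≤-reflexive (sym (ℕ.+-identityʳ t)))) (ℕ.+-monoˡ-≤ (t + 0) 0<t)))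
    small : ∀ {a} → 0 < a → a ≤ suc t → Smooth (PrimePerFactor p) a
    small = smooth-small {b = suc t} (λ r≤1+t → inj₁ (ℕ.≤-<-trans r≤1+t 1+t<p , p∤D))

  -- Exponents with controlled prime factors

  Below : ℕ → ℕ → Set
  Below q r = r < q ⊎ r ∣ D

  PerBelow : ℕ → ℕ → Set
  PerBelow q m = ∃[ k ] (0 < k × Smooth (Below q) k × Per m k)

  -- The exponents of p and of m are multiplied together. The bound p ≤ q is not strict: adjoining q
  -- itself still yields an exponent whose primes are below q or divide D, and so the prime q
  -- disappears. 4 ≤ q makes room for 2 and 3.
  perBelow-*-coprime : ∀ {q p m} → 4 ≤ q → Prime p → ¬ p ∣ m → p ≤ q ⊎ p ∣ D → PerBelow q m → PerBelow q (p * m)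
  perBelow-*-coprime {q} {p} {m} 4≤q pr p∤m p≤q⊎p∣D (k , 0<k , smooth , per) with primePer pr
  ... | k′ , 0<k′ , smooth′ , per′ = k′ * k , ℕ.*-mono-≤ 0<k′ 0<k
      , smooth-* {a = k′} {k} (smooth-map (λ _ → below) smooth′) smooth
      , per-coprime (prime∤⇒coprime pr p∤m)
          (per-multiple (m∣m*n k) per′) (per-multiple (n∣m*n k′) per)
    where
    below : ∀ {r} → PrimePerFactor p r → Below q r
    below (inj₁ (r<p , p∤D)) = [ (λ p≤q → inj₁ (ℕ.<-≤-trans r<p p≤q)) , (λ p∣D → contradiction p∣D p∤D) ]′ p≤q⊎p∣D
    below (inj₂ (inj₁ r<4)) = inj₁ (ℕ.<-≤-trans r<4 4≤q)
    below (inj₂ (inj₂ r∣D)) = inj₂ r∣D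

  -- A prime already present is multiplied onto modulus and exponent alike; a new one brings its own
  -- exponent.
  perBelow : ∀ {q m} → 4 ≤ q → 0 < m → Smooth (Below q) m → PerBelow q m
  perBelow {q} 4≤q = smooth-induction (PerBelow q) (1 , s≤s z≤n , smooth-1 , per-1 1) step
    where
    step : ∀ {p m} → Prime p → Below q p → PerBelow q m → PerBelow q (p * m)
    step {p} {m} pr below perBelow-m@(k , 0<k , smooth , per) with p ∣? m
    ... | yes p∣m = p * k , ℕ.*-mono-≤ (prime>0 pr) 0<k
                  , smooth-* {a = p} {k} (smooth-prime pr below) smooth
                  , per-lift p∣m per
    ... | no p∤m = perBelow-*-coprime 4≤q pr p∤m ([ inj₁ ∘ ℕ.<⇒≤ , inj₂ ]′ below) perBelow-m

  -- Starting from 144 and 24, a prime that divides the modulus lifts both sides. Any other prime is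
  -- neither 2 nor 3, hence divides D.
  per-144*-24* : ∀ {y} → 0 < y → Smooth (Below 4) y → Per (144 * y) (24 * y)
  per-144*-24* = smooth-induction (λ y → Per (144 * y) (24 * y)) per-144-24 step
    where
    swap : ∀ c p y → p * (c * y) ≡ c * (p * y)
    swap = solve-∀
    6yp : ∀ p y → 24 * (p * y) ≡ 6 * y * (p * 2 * 2)
    6yp = solve-∀
    step : ∀ {p y} → Prime p → Below 4 p → Per (144 * y) (24 * y) → Per (144 * (p * y)) (24 * (p * y))
    step {p} {y} pr below per with p ∣? 144 * y
    ... | yes p∣144y = ≡.subst₂ Per (swap 144 p y) (swap 24 p y) (per-lift p∣144y per)
    ... | no p∤144y = subst (λ m → Per m (24 * (p * y))) (swap 144 p y)
          (per-coprime (prime∤⇒coprime pr p∤144y)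
            -- The exponent 4p of a prime dividing D divides 24py, with quotient 6y.
            (per-multiple (divides (6 * y) (6yp p y)) (ramifiedPer pr p≢2 (p∣D below)))
            (per-multiple (divides p (sym (swap 24 p y))) per))
      where
      p≢2 : ¬ p ≡ 2
      p≢2 refl = p∤144y (∣m⇒∣m*n {2} {144} y (from-yes (2 ∣? 144)))
      p∣D : Below 4 p → p ∣ D
      p∣D (inj₂ p∣D) = p∣D
      p∣D (inj₁ p<4) with prime<4 pr p<4
      ... | inj₁ p≡2 = contradiction p≡2 p≢2
      ... | inj₂ refl = contradiction (∣m⇒∣m*n {3} {144} y (from-yes (3 ∣? 144))) p∤144y

  -- Descent to divisors of 24e

  -- The bound covers all divisors m of M, because the descent knows only multiples of π(m). The
  -- number e may vary with m and n, but the threshold may not.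
  record Absorbed (M : ℕ) : Set where
    constructor mkAbsorbed
    field
      threshold : ℕ
      bound : ∀ {m x} n → m ∣ M → threshold ≤ n → PiIter K n m x → ∃[ e ] (Smooth (_∣ D) e × x ∣ 24 * e)

  absorbed-∣ : ∀ {M M′} → M ∣ M′ → Absorbed M′ → Absorbed M
  absorbed-∣ M∣M′ (mkAbsorbed N absorbed) = mkAbsorbed N λ n m∣M → absorbed n (∣-trans m∣M M∣M′)

  -- One application of π sends every divisor of M to a divisor of k, so the threshold grows by one.
  absorbed-per : ∀ {M k} → Per M k → Absorbed k → Absorbed M
  absorbed-per per (mkAbsorbed N absorbed) = mkAbsorbed (suc N) λ { (suc n) m∣M (s≤s N≤n) it →
    let y , pi , it′ = PiIter-unroll n it in absorbed n (isPi∣ pi m∣M per) N≤n it′ }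

  24∣144 : ∀ {c} z → c ∣ 6 → 24 * (c * z) ∣ 144 * z
  24∣144 {c} z c∣6 = subst (_∣ 144 * z) (ℕ.*-assoc 24 c z) (*-monoˡ-∣ {24 * c} {144} z (*-monoʳ-∣ {c} {6} 24 c∣6))

  -- The divisors of 24e are closed under π: they divide 144e, for which 24e is an exponent.
  absorbed-24 : ∀ {e} → 0 < e → Smooth (_∣ D) e → Absorbed (24 * e)
  absorbed-24 {e} 0<e smooth = mkAbsorbed 0 λ n m∣24e _ it → e , smooth , go n m∣24e it
    where
    go : ∀ n {m x} → m ∣ 24 * e → PiIter K n m x → x ∣ 24 * e
    go zero m∣24e refl = m∣24e
    go (suc n) m∣24e (y , it , pi) = isPi∣ {n = 144 * e} {k = 24 * e} pi
      (∣-trans (go n m∣24e it) (*-monoˡ-∣ e (from-yes (24 ∣? 144))))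
      (per-144*-24* 0<e (smooth-map (λ _ → inj₂) smooth))

  -- Used for c = 2 and c = 3. As 24c divides 144, each application of π replaces 24c^(j+1)z by
  -- 24c^j z.
  absorbed-24* : ∀ {c z} j → c ∣ 6 → 0 < c → 0 < z → Smooth (Below 4) c → Smooth (Below 4) z → Absorbed (24 * z) → Absorbed (24 * (c ^ j * z))
  absorbed-24* {c} {z} zero _ _ _ _ _ absorbed = subst (λ z → Absorbed (24 * z)) (sym (ℕ.*-identityˡ z)) absorbed
  absorbed-24* {c} {z} (suc j) c∣6 0<c 0<z sc sz absorbed = subst (λ z → Absorbed (24 * z)) (sym (ℕ.*-assoc c (c ^ j) z))
    (absorbed-∣ (24∣144 (c ^ j * z) c∣6) (absorbed-per {144 * (c ^ j * z)} {24 * (c ^ j * z)}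
      (per-144*-24* (ℕ.*-mono-≤ (ℕ.m^n>0 c {{ℕ.>-nonZero 0<c}} j) 0<z) (smooth-* {a = c ^ j} (smooth-^ j sc) sz))
      (absorbed-24* j c∣6 0<c 0<z sc sz absorbed)))

  -- M = 2^a 3^b e is enlarged to 24M; the powers of 2 are removed first, then those of 3, until 24e
  -- is left.
  absorbed-below-4 : ∀ {M} → 0 < M → Smooth (Below 4) M → Absorbed M
  absorbed-below-4 {M} 0<M smooth
    with a , M′ , refl , 0<M′ , smooth′ ← splitPrime {P′ = λ r → r ≡ 3 ⊎ r ∣ D} 2 (λ pr → [ (λ r<4 → [ inj₁ , inj₂ ∘ inj₁ ]′ (prime<4 pr r<4)) , inj₂ ∘ inj₂ ]′) 0<M smooth
    with b , e , refl , 0<e , smooth″ ← splitPrime {P′ = _∣ D} 3 (λ _ r → r) 0<M′ smooth′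
    = absorbed-∣ (n∣m*n 24 {2 ^ a * (3 ^ b * e)})
        (absorbed-24* {2} {3 ^ b * e} a (divides 3 refl) (s≤s z≤n) 0<M′ (small (s≤s z≤n) (s≤s (s≤s z≤n)))
          (smooth-map (λ _ → [ (λ { refl → inj₁ (s≤s (s≤s (s≤s (s≤s z≤n)))) }) , inj₂ ]′) smooth′)
        (absorbed-24* {3} {e} b (divides 2 refl) (s≤s z≤n) 0<e (small (s≤s z≤n) (s≤s (s≤s (s≤s z≤n))))
          (smooth-map (λ _ → inj₂) smooth″)
        (absorbed-24 0<e smooth″)))
    where
    small : ∀ {c} → 0 < c → c ≤ 3 → Smooth (Below 4) c
    small = smooth-small (λ r≤3 → inj₁ (s≤s r≤3))

  per-q^j* : ∀ {q M k} j → Per (q * M) k → Per (q ^ suc j * M) (q ^ j * k)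
  per-q^j* {q} {M} {k} zero h = ≡.subst₂ Per (cong (_* M) (sym (ℕ.*-identityʳ q))) (sym (ℕ.*-identityˡ k)) h
  per-q^j* {q} {M} {k} (suc j) h = ≡.subst₂ Per (sym (ℕ.*-assoc q (q ^ suc j) M)) (sym (ℕ.*-assoc q (q ^ j) k))
    (per-lift {c = q} (∣m⇒∣m*n M (m∣m*n (q ^ j))) (per-q^j* {q} {M} j h))

  -- q does not divide M, and qM has an exponent k whose primes are below q or divide D. Hence q^j k
  -- is an exponent for q^(j+1) M: the power of q drops by one while k takes the place of M.
  absorbed-q^j* : ∀ {q} → 4 ≤ q → Prime q → ¬ q ∣ D → (∀ {M} → 0 < M → Smooth (Below q) M → Absorbed M) →
    ∀ j {M} → 0 < M → Smooth (Below q) M → Absorbed (q ^ j * M)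
  absorbed-q^j* {q} 4≤q pr q∤D absorbed zero {M} 0<M smooth = subst Absorbed (sym (ℕ.*-identityˡ M)) (absorbed 0<M smooth)
  absorbed-q^j* {q} 4≤q pr q∤D absorbed (suc j) {M} 0<M smooth =
    let k , 0<k , smooth-k , h = perBelow-*-coprime 4≤q pr
          (λ q∣M → [ ℕ.<-irrefl refl , q∤D ]′ (smooth q pr q∣M)) (inj₁ ℕ.≤-refl) (perBelow 4≤q 0<M smooth)
    in absorbed-per (per-q^j* {q} {M} j h) (absorbed-q^j* 4≤q pr q∤D absorbed j 0<k smooth-k)

  -- Induction on the bound. The number 4 + q needs treatment only if it is a prime not dividing D;
  -- otherwise the bound decreases at once.
  absorbed-below : ∀ q {M} → 0 < M → Smooth (Below (4 + q)) M → Absorbed M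
  absorbed-below zero 0<M smooth = absorbed-below-4 0<M smooth
  absorbed-below (suc q) {M} 0<M smooth with prime? (4 + q) | (4 + q) ∣? D
  ... | yes pr | no ∤D
      with j , M′ , refl , 0<M′ , smooth′ ← splitPrime {P′ = Below (4 + q)} (4 + q)
             (λ _ → [ (λ { (s≤s r≤4+q) → [ inj₂ ∘ inj₁ , inj₁ ]′ (ℕ.m≤n⇒m<n∨m≡n r≤4+q) }) , inj₂ ∘ inj₂ ]′) 0<M smooth
      = absorbed-q^j* (ℕ.m≤m+n 4 q) pr ∤D (absorbed-below q) j 0<M′ smooth′
  ... | no ¬pr | _ = absorbed-below q 0<M (smooth-map
          (λ pr → [ (λ { (s≤s r≤4+q) → [ inj₁ , (λ { refl → contradiction pr ¬pr }) ]′ (ℕ.m≤n⇒m<n∨m≡n r≤4+q) }) , inj₂ ]′) smooth)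
  ... | yes _ | yes ∣D = absorbed-below q 0<M (smooth-map
          (λ _ → [ (λ { (s≤s r≤4+q) → [ inj₁ , (λ { refl → inj₂ ∣D }) ]′ (ℕ.m≤n⇒m<n∨m≡n r≤4+q) }) , inj₂ ]′) smooth)

  all-below : ∀ {m} → 0 < m → Smooth (Below (4 + m)) m
  all-below {m} 0<m = smooth-small (λ r≤m → inj₁ (s≤s (ℕ.m≤n⇒m≤o+n 3 r≤m))) 0<m ℕ.≤-refl

  absorbed : ∀ {m} → 0 < m → Absorbed m
  absorbed {m} 0<m = absorbed-below m 0<m (all-below 0<m)

  -- Existence of the iterates and the conclusion

  -- The periodicity condition for all n follows from n = 0 and n = 1, which leaves two divisibility
  -- tests.
  isPeriod? : ∀ m k → Dec (IsPeriod K m k)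
  isPeriod? m k = map′ (λ (0<k , F≡0 , F≡1) → isPeriod 0<k (mod⇒Per F≡0 F≡1)) (λ (0<k , h) → 0<k , h 0 , h 1)
    ((0 ℕ.<? k) ×-dec ((m ∣? ℕ.∣ kfib K k - 0 ∣) ×-dec (m ∣? ℕ.∣ kfib K (suc k) - 1 ∣)))

  -- The bound 4 + m exceeds every prime factor of m, so `perBelow` supplies some period; a least
  -- one is found by decidability.
  π-exists : ∀ {m} → 0 < m → ∃[ x ] IsPi K m x
  π-exists {m} 0<m =
    let k , 0<k , _ , h = perBelow (ℕ.m≤m+n 4 m) 0<m (all-below 0<m) in least (isPeriod? m) (isPeriod 0<k h)

  π^n-exists : ∀ n {m} → 0 < m → ∃[ x ] (0 < x × PiIter K n m x)
  π^n-exists zero 0<m = _ , 0<m , refl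
  π^n-exists (suc n) 0<m =
    let y , 0<y , it = π^n-exists n 0<m
        x , pi = π-exists 0<y
    in x , proj₁ (proj₁ pi) , y , it , pi

  eventually : ∀ m → 1 < m → ∃[ N ] (∀ n → N ≤ n → 1 ≤ n →
    ∃[ x ] (PiIter K n m x × ∃[ e ] (x ≡ 24 * e × (∀ p → Prime p → p ∣ e → p ∣ K * K + 4))))
  -- From `threshold` on the iterate divides 24e; from the fifth on it is a multiple of 24.
  eventually m 1<m = threshold ℕ.⊔ 5 , λ n N⊔5≤n _ →
    let x , _ , it = π^n-exists n 0<m
        e , smooth , x∣24e = bound n ∣-refl (ℕ.m⊔n≤o⇒m≤o threshold 5 N⊔5≤n) it
        5≤n = ℕ.m⊔n≤o⇒n≤o threshold 5 N⊔5≤n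
        24∣x = 24∣π^[5+n] (n ℕ.∸ 5) 1<m (subst (λ n → PiIter K n m x) (sym (ℕ.m+[n∸m]≡n 5≤n)) it)
        x≡24e′ = m∣n⇒n≡m*quotient 24∣x
    in x , it , quotient 24∣x , x≡24e′
     -- Cancelling 24 shows that the quotient of x by 24 divides e, so its primes divide D.
     , smooth-∣ (*-cancelˡ-∣ 24 (subst (_∣ 24 * e) x≡24e′ x∣24e)) smooth
    where
    0<m : 0 < m
    0<m = ℕ.<-trans (s≤s z≤n) 1<m
    open Absorbed (absorbed 0<m)

-- Squares modulo 24

-- For K = 6q + 1 and K = 6q + 5, K² - 1 is 12q(3q + 1) and 12(q + 1)(3q + 2). The remaining factor
-- 2 depends on the parity of q, whence four cases.
square-mod-24 : ∀ K → K % 6 ≡ 1 ⊎ K % 6 ≡ 5 → ∃[ j ] ∃[ s ] (K ≡ 1 + 2 * j × K * K ≡ 1 + 24 * s)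
square-mod-24 K K%6 = cases K%6 (parity (K / 6))
  where
  at : ∀ {r q} j s → r + q * 6 ≡ 1 + 2 * j → (r + q * 6) * (r + q * 6) ≡ 1 + 24 * s →
    K % 6 ≡ r → K / 6 ≡ q → ∃[ j ] ∃[ s ] (K ≡ 1 + 2 * j × K * K ≡ 1 + 24 * s)
  at j s e f refl refl = j , s ,
    subst (λ k → k ≡ 1 + 2 * j × k * k ≡ 1 + 24 * s) (sym (m≡m%n+[m/n]*n K 6)) (e , f)
  j₁ : ∀ i → 1 + 2 * i * 6 ≡ 1 + 2 * (6 * i)
  j₁ = solve-∀
  s₁ : ∀ i → (1 + 2 * i * 6) * (1 + 2 * i * 6) ≡ 1 + 24 * (i * (6 * i + 1))
  s₁ = solve-∀
  j₅ : ∀ i → 5 + 2 * i * 6 ≡ 1 + 2 * (6 * i + 2)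
  j₅ = solve-∀
  s₅ : ∀ i → (5 + 2 * i * 6) * (5 + 2 * i * 6) ≡ 1 + 24 * ((3 * i + 1) * (2 * i + 1))
  s₅ = solve-∀
  j₇ : ∀ i → 1 + suc (2 * i) * 6 ≡ 1 + 2 * (6 * i + 3)
  j₇ = solve-∀
  s₇ : ∀ i → (1 + suc (2 * i) * 6) * (1 + suc (2 * i) * 6) ≡ 1 + 24 * ((2 * i + 1) * (3 * i + 2))
  s₇ = solve-∀
  j₁₁ : ∀ i → 5 + suc (2 * i) * 6 ≡ 1 + 2 * (6 * i + 5)
  j₁₁ = solve-∀
  s₁₁ : ∀ i → (5 + suc (2 * i) * 6) * (5 + suc (2 * i) * 6) ≡ 1 + 24 * ((6 * i + 5) * (i + 1))
  s₁₁ = solve-∀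
  cases : K % 6 ≡ 1 ⊎ K % 6 ≡ 5 → ∃[ i ] (K / 6 ≡ 2 * i ⊎ K / 6 ≡ suc (2 * i)) →
    ∃[ j ] ∃[ s ] (K ≡ 1 + 2 * j × K * K ≡ 1 + 24 * s)
  cases (inj₁ r≡1) (i , inj₁ even) = at (6 * i) (i * (6 * i + 1)) (j₁ i) (s₁ i) r≡1 even
  cases (inj₂ r≡5) (i , inj₁ even) = at (6 * i + 2) ((3 * i + 1) * (2 * i + 1)) (j₅ i) (s₅ i) r≡5 even
  cases (inj₁ r≡1) (i , inj₂ odd) = at (6 * i + 3) ((2 * i + 1) * (3 * i + 2)) (j₇ i) (s₇ i) r≡1 odd
  cases (inj₂ r≡5) (i , inj₂ odd) = at (6 * i + 5) ((6 * i + 5) * (i + 1)) (j₁₁ i) (s₁₁ i) r≡5 odd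

theorem4p5 : (K : ℕ) → 1 ≤ K → (K % 6 ≡ 1 ⊎ K % 6 ≡ 5) →
    (m : ℕ) → 1 < m →
    ∃[ N ] (∀ n → N ≤ n → 1 ≤ n →
    ∃[ x ] (PiIter K n m x ×
    ∃[ e ] (x ≡ 24 * e × (∀ p → Prime p → p ∣ e → p ∣ K * K + 4))))
theorem4p5 K _ K%6 =
  let j , s , K≡1+2j , K²≡1+24s = square-mod-24 K K%6 in Coprime6.eventually K j s K≡1+2j K²≡1+24s
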